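{- For every integer $k\ge 0$ there is an integer $R_k$, not depending on $q$, such that for every prime power $q$ and every integer $r\ge R_k$, \[ \mathrm{ex}_q(r,k)=\begin{cases}\binom{r+1}{k} & \text{if } q=2 \text{ and } k \text{ is even},\\[2pt] \binom{r}{k}(q-1)^k & \text{otherwise.}\end{cases} \]
   Context: $F_q$ is the finite field with $q$ elements. The weight of a vector is its number of nonzero entries. $\mathrm{ex}_q(r,k)$ denotes the maximum number of distinct columns of a matrix over $F_q$ (with any number of rows) such that every column has weight exactly $k$ and the matrix has rank at most $r$. -}

module Defs where

open import Level using (0ℓ)
open import Algebra.Bundles using (CommutativeRing)
import Algebra.Definitions.RawMonoid as RawMonoidDefs
open import Data.Nat using (ℕ; _≤_)
open import Data.Fin using (Fin)
open import Data.Fin.Subset using (Subset; _∈_; ∣_∣)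
open import Data.Product using (Σ; ∃; _×_)
open import Relation.Nullary using (¬_)
open import Relation.Binary.PropositionalEquality using (_≡_; _≢_)
open import Function.Bundles using (_⇔_)

record FiniteField : Set₁ where
  field
    commRing : CommutativeRing 0ℓ 0ℓ
  open CommutativeRing commRing public
  field
    1≉0     : ¬ (1# ≈ 0#)
    inverse : ∀ x → ¬ (x ≈ 0#) → ∃ λ y → (x * y) ≈ 1#
    q       : ℕ
    enum    : Fin q → Carrier
    enum-injective  : ∀ i j → enum i ≈ enum j → i ≡ j
    enum-surjective : ∀ x → ∃ λ i → enum i ≈ x

module _ (F : FiniteField) where
  open FiniteField F
  open RawMonoidDefs +-rawMonoid using (sum)

  Vec𝔽 : ℕ → Set
  Vec𝔽 n = Fin n → Carrier

  HasWeight : ∀ {n} → Vec𝔽 n → ℕ → Set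
  HasWeight {n} v k =
    Σ (Subset n) λ S → (∣ S ∣ ≡ k) × (∀ i → (i ∈ S) ⇔ (¬ (v i ≈ 0#)))

  DistinctCols : ∀ {n m} → (Fin m → Vec𝔽 n) → Set
  DistinctCols {n} {m} c = ∀ i j → i ≢ j → ¬ (∀ t → c i t ≈ c j t)

  -- the n×m matrix with columns c has rank at most r:
  -- its column space is spanned by r vectors b₁,…,b_r
  RankAtMost : ∀ {n m} → (Fin m → Vec𝔽 n) → ℕ → Set
  RankAtMost {n} {m} c r =
    Σ (Fin r → Vec𝔽 n) λ b →
    Σ (Fin m → Fin r → Carrier) λ a →
      ∀ i t → c i t ≈ sum (λ s → a i s * b s t)

  Achievable : ℕ → ℕ → ℕ → Set
  Achievable r k m =
    Σ ℕ λ n → Σ (Fin m → Vec𝔽 n) λ c →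
      DistinctCols c × (∀ i → HasWeight (c i) k) × RankAtMost c r

  IsEx : ℕ → ℕ → ℕ → Set
  IsEx r k m = Achievable r k m × (∀ m′ → Achievable r k m′ → m′ ≤ m)

{-# OPTIONS --safe #-}

-- Gaussian elimination puts a rank r matrix in systematic form: its columns become distinct
-- x ∈ F^r with wt x + wt (Ax) = k.  So at most N_k + N_{k-1} + ⋯ + N_0 columns occur, where
-- N_j = C(r,j)(q−1)^j counts the vectors of weight j, and each x of weight k with Ax ≠ 0
-- (a miss) lowers this bound by one.  The excess N_{k-1} + ⋯ + N_0 has order r^{k-1}.
-- For q ≥ 3 two nonzero columns of A already give about 2 N_{k-1} misses, which beats it.
-- For q = 2 a pair of distinct columns of A gives about N_{k-1} misses: one pair suffices for
-- even k, where C(r+1,k) = N_k + N_{k-1}, and two disjoint pairs suffice for odd k.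
-- Matrices A with almost all columns equal are counted directly.
module Submission where

open import Defs
open import Data.Nat using (ℕ; _≤_; _^_; _*_; _+_; _∸_)
open import Data.Nat.Combinatorics using (_C_)
open import Data.Nat.Divisibility using (_∣_)
open import Data.Product using (Σ; _×_)
open import Relation.Nullary using (¬_)
open import Relation.Binary.PropositionalEquality using (_≡_)
import Algebra.Definitions.RawMonoid as RawMonoidDefs
import Algebra.Properties.CommutativeMonoid.Sum as Sum
import Algebra.Solver.Ring.NaturalCoefficients.Default as SemiringSolver
import Relation.Binary.Reasoning.Setoid as SetoidReasoning
open import Data.Fin using (Fin; zero; suc; punchIn; punchOut)
import Data.Fin.Properties as Fin
open import Data.Fin.Properties using (+↔⊎; injective⇒≤; all?; ¬∀⟶∃¬; punchInᵢ≢i; punchIn-injective; punchIn-punchOut)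
open import Data.Fin.Subset using (Subset; inside; outside; ∣_∣) renaming (_∈_ to _∈ₛ_)
open import Data.Fin.Subset.Properties using (drop-there)
open import Data.Nat using (zero; suc; z≤n; s≤s; _<_; _⊔_)
open import Data.Nat.Combinatorics using (nCk+nC[k+1]≡[n+1]C[k+1])
open import Data.Nat.Combinatorics.Specification using (k>n⇒nCk≡0)
open import Data.Nat.Divisibility using (∣m∣n⇒∣m+n; ∣m+n∣m⇒∣n; _∣0; ∣-refl; ∣1⇒≡1)
open import Data.Nat.Properties
open import Data.Nat.Tactic.RingSolver using (solve-∀)
open import Data.Product using (∃; _,_; proj₁; proj₂)
open import Data.Sum using (_⊎_; inj₁; inj₂)
open import Data.Vec using (Vec; []; _∷_; map; tabulate; lookup; replicate; here; there)
open import Data.Vec.Functional using (updateAt)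
open import Data.Vec.Functional.Properties using (updateAt-minimal)
open import Data.Vec.Properties using (∷-injective; tabulate∘lookup; tabulate-cong)
open import Data.Vec.Relation.Unary.All as All using (All; []; _∷_)
open import Function using (_∘_; id; const)
open import Function.Bundles using (_↔_; _⇔_; mk↔ₛ′; mk⇔; Inverse; Equivalence)
open import Relation.Nullary using (Dec; yes; no; contradiction)
open import Relation.Nullary.Decidable using (map′; decidable-stable)
open import Relation.Binary.PropositionalEquality using (_≢_; refl; sym; trans; cong; cong₂; subst; module ≡-Reasoning)

-- The threshold must serve all q at once. A `sphere` of weight e carries the factor Q^e exactly,
-- and a `ball` of weights at most e carries at most Q^e, so every comparison reduces to Q = 1,
-- where it concerns polynomials in r. There the leading coefficient decides: 1 for the excess
-- against 2 for two batches of misses. The shift by four comes from the two disjoint pairs: misses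
-- are counted over the columns that remain, at most four fewer, and this leaves leading
-- coefficients unchanged. Parity matters for q = 2 because misses can be absent altogether: if all
-- columns of A equal v, then Ax = 0 for every x of even weight, which makes room for the larger
-- value C(r+1,k). For odd k and v nonzero, the same A misses every x of weight k.

open Sum +-0-commutativeMonoid
  using (sum-cong-≗; ∑-distrib-+; ∑-comm)
  renaming (sum to ∑)

-- Sizes of Hamming spheres and balls

-- Numbers of vectors of weight exactly e, respectively strictly below e, in F^r with |F| = Q + 1.
sphere ball : ℕ → ℕ → ℕ → ℕ
sphere Q r       zero    = 1
sphere Q zero    (suc e) = 0
sphere Q (suc r) (suc e) = sphere Q r (suc e) + Q * sphere Q r e
ball Q r       zero    = 0
ball Q zero    (suc e) = 1
ball Q (suc r) (suc e) = ball Q r (suc e) + Q * ball Q r e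

sphere≡C*^ : ∀ Q r e → sphere Q r e ≡ (r C e) * Q ^ e
sphere≡C*^ Q r       zero    = refl
sphere≡C*^ Q zero    (suc e) = cong (_* Q ^ suc e) (sym (k>n⇒nCk≡0 {0} {suc e} (s≤s z≤n)))
sphere≡C*^ Q (suc r) (suc e) = begin
  sphere Q r (suc e) + Q * sphere Q r e
    ≡⟨ cong₂ (λ x y → x + Q * y) (sphere≡C*^ Q r (suc e)) (sphere≡C*^ Q r e) ⟩
  (r C suc e) * (Q * Q ^ e) + Q * ((r C e) * Q ^ e)
    ≡⟨ regroup (r C suc e) (r C e) Q (Q ^ e) ⟩
  (r C e + r C suc e) * (Q * Q ^ e)
    ≡⟨ cong (_* (Q * Q ^ e)) (nCk+nC[k+1]≡[n+1]C[k+1] r e) ⟩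
  (suc r C suc e) * Q ^ suc e ∎
  where
  open ≡-Reasoning
  regroup : ∀ a b c d → a * (c * d) + c * (b * d) ≡ (b + a) * (c * d)
  regroup = solve-∀

sphere-mono : ∀ Q r e → sphere Q r e ≤ sphere Q (suc r) e
sphere-mono Q r zero    = ≤-refl
sphere-mono Q r (suc e) = m≤m+n _ _

ball-mono : ∀ Q r e → ball Q r e ≤ ball Q (suc r) e
ball-mono Q r zero    = ≤-refl
ball-mono Q r (suc e) = m≤m+n _ _

sphere-scale : ∀ Q r e → sphere Q r e ≡ Q ^ e * sphere 1 r e
sphere-scale Q r e = begin
  sphere Q r e              ≡⟨ sphere≡C*^ Q r e ⟩
  (r C e) * Q ^ e           ≡⟨ *-comm (r C e) (Q ^ e) ⟩
  Q ^ e * (r C e)           ≡⟨ cong (Q ^ e *_) (sym (trans (sphere≡C*^ 1 r e) (trans (cong ((r C e) *_) (^-zeroˡ e)) (*-identityʳ _)))) ⟩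
  Q ^ e * sphere 1 r e      ∎
  where open ≡-Reasoning

-- The ball counts supports of size at most e, and over an alphabet with `suc Q` nonzero letters
-- each such support carries at most `suc Q ^ e` vectors. With no nonzero letter the zero vector
-- alone would break the bound, hence `suc Q`.
ball-scale-suc : ∀ Q r e → ball (suc Q) r (suc e) ≤ suc Q ^ e * ball 1 r (suc e)
ball-scale-suc Q zero    e       = subst (1 ≤_) (sym (*-identityʳ (suc Q ^ e))) (m^n>0 (suc Q) e)
ball-scale-suc Q (suc r) zero    = begin
  ball (suc Q) r 1 + suc Q * 0   ≡⟨ cong (ball (suc Q) r 1 +_) (*-zeroʳ (suc Q)) ⟩
  ball (suc Q) r 1 + 0           ≤⟨ +-monoˡ-≤ 0 (ball-scale-suc Q r zero) ⟩
  1 * ball 1 r 1 + 0             ≡⟨ cong (_+ 0) (*-identityˡ (ball 1 r 1)) ⟩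
  ball 1 r 1 + 0                 ≡⟨ sym (*-identityˡ _) ⟩
  1 * (ball 1 r 1 + 0)           ∎
  where open ≤-Reasoning
ball-scale-suc Q (suc r) (suc e) = begin
  ball q r (2 + e) + q * ball q r (suc e)
    ≤⟨ +-mono-≤ (ball-scale-suc Q r (suc e)) (*-monoʳ-≤ q (ball-scale-suc Q r e)) ⟩
  q * q ^ e * ball 1 r (2 + e) + q * (q ^ e * ball 1 r (suc e))
    ≡⟨ regroup q (q ^ e) (ball 1 r (2 + e)) (ball 1 r (suc e)) ⟩
  q * q ^ e * (ball 1 r (2 + e) + (ball 1 r (suc e) + 0)) ∎
  where
  open ≤-Reasoning
  q = suc Q
  regroup : ∀ a b c d → a * b * c + a * (b * d) ≡ a * b * (c + (d + 0))
  regroup = solve-∀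

ball-scale : ∀ Q r e → ball (suc Q) r e ≤ suc Q ^ e * ball 1 r e
ball-scale Q r zero    = z≤n
ball-scale Q r (suc e) = ≤-trans (ball-scale-suc Q r e)
  (*-monoˡ-≤ (ball 1 r (suc e)) (m≤m+n (suc Q ^ e) _))

-- Comparison of balls and spheres for large r

Eventually : (ℕ → Set) → Set
Eventually P = ∃ λ R → ∀ r → R ≤ r → P r

eventually-∧ : ∀ {P P′ : ℕ → Set} → Eventually P → Eventually P′ → Eventually (λ r → P r × P′ r)
eventually-∧ (R , p) (R′ , p′) = R ⊔ R′ , λ r h →
  p r (≤-trans (m≤m⊔n R R′) h) , p′ r (≤-trans (m≤n⊔m R R′) h)

-- From R on, g gains at least one on f at each step. The initial deficit is at most `f R`, so
-- `suc (f R)` further steps suffice.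
eventually-< : ∀ (f g f′ g′ : ℕ → ℕ) →
  (∀ r → f (suc r) ≡ f r + f′ r) → (∀ r → g (suc r) ≡ g r + g′ r) →
  Eventually (λ r → f′ r < g′ r) → Eventually (λ r → f r < g r)
eventually-< f g f′ g′ f-step g-step (R , h) = suc (f R) + R , λ r R≤r →
  subst (λ r → f r < g r) (m∸n+n≡m (≤-trans (m≤n+m R (suc (f R))) R≤r))
    (+-cancelˡ-< (f R) _ _ (<-≤-trans
      (+-monoˡ-< (f (r ∸ R + R)) (m+n≤o⇒m≤o∸n (suc (f R)) R≤r))
      (overtake (r ∸ R))))
  where
  overtake : ∀ d → d + f (d + R) ≤ f R + g (d + R)
  overtake zero    = m≤m+n (f R) (g R)
  overtake (suc d) = begin
    suc d + f (suc d + R)                ≡⟨ cong (suc d +_) (f-step (d + R)) ⟩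
    suc d + (f (d + R) + f′ (d + R))     ≡⟨ shuffle d (f (d + R)) (f′ (d + R)) ⟩
    (d + f (d + R)) + suc (f′ (d + R))   ≤⟨ +-mono-≤ (overtake d) (h (d + R) (m≤n+m R d)) ⟩
    (f R + g (d + R)) + g′ (d + R)       ≡⟨ +-assoc (f R) _ _ ⟩
    f R + (g (d + R) + g′ (d + R))       ≡⟨ cong (f R +_) (sym (g-step (d + R))) ⟩
    f R + g (suc d + R)                  ∎
    where
    open ≤-Reasoning
    shuffle : ∀ a b c → suc a + (b + c) ≡ (a + b) + suc c
    shuffle = solve-∀

-- By Pascal's rule the finite difference in r of either side is the same side for e − 1.
ball<sphere : ∀ e → Eventually (λ r → ball 1 (4 + r) e < sphere 1 r e)
ball<sphere zero    = 0 , λ _ _ → s≤s z≤n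
ball<sphere (suc e) = eventually-< (λ r → ball 1 (4 + r) (suc e)) (λ r → sphere 1 r (suc e)) _ _
  (λ r → cong (ball 1 (4 + r) (suc e) +_) (*-identityˡ _))
  (λ r → cong (sphere 1 r (suc e) +_) (*-identityˡ _))
  (ball<sphere e)

-- The leading terms are C(r,e) against 2 C(r,e), so neither the shift by four nor the lower weights
-- matter; taking differences e times leaves 1 < 2.
ball<2*sphere : ∀ e → Eventually (λ r → ball 1 (4 + r) (suc e) < sphere 1 r e + sphere 1 r e)
ball<2*sphere zero    = 0 , λ r _ → s≤s (≤-reflexive (ball≡1 (4 + r)))
  where
  ball≡1 : ∀ r → ball 1 r 1 ≡ 1
  ball≡1 zero    = refl
  ball≡1 (suc r) = trans (+-identityʳ _) (ball≡1 r)
ball<2*sphere (suc e) = eventually-<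
  (λ r → ball 1 (4 + r) (2 + e)) (λ r → sphere 1 r (suc e) + sphere 1 r (suc e)) _ _
  (λ r → cong (ball 1 (4 + r) (2 + e) +_) (*-identityˡ _))
  (λ r → interchange (sphere 1 r (suc e)) (sphere 1 r e))
  (ball<2*sphere e)
  where
  interchange : ∀ a b → a + (b + 0) + (a + (b + 0)) ≡ a + a + (b + b)
  interchange = solve-∀

ball≤sphere : ∀ {Q} r e → 1 ≤ Q → ball 1 (4 + r) e < sphere 1 r e → ball Q (4 + r) e ≤ sphere Q r e
ball≤sphere {suc Q} r e _ h = begin
  ball (suc Q) (4 + r) e            ≤⟨ ball-scale Q (4 + r) e ⟩
  suc Q ^ e * ball 1 (4 + r) e      ≤⟨ *-monoʳ-≤ (suc Q ^ e) (<⇒≤ h) ⟩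
  suc Q ^ e * sphere 1 r e          ≡⟨ sym (sphere-scale (suc Q) r e) ⟩
  sphere (suc Q) r e                ∎
  where open ≤-Reasoning

ball≤2*sphere : ∀ {Q} r e → 1 ≤ Q → ball 1 (4 + r) (suc e) < sphere 1 r e + sphere 1 r e →
  ball Q (4 + r) (suc e) ≤ sphere Q r e + sphere Q r e
ball≤2*sphere {suc Q} r e _ h = begin
  ball (suc Q) (4 + r) (suc e)                            ≤⟨ ball-scale-suc Q (4 + r) e ⟩
  suc Q ^ e * ball 1 (4 + r) (suc e)                      ≤⟨ *-monoʳ-≤ (suc Q ^ e) (<⇒≤ h) ⟩
  suc Q ^ e * (sphere 1 r e + sphere 1 r e)               ≡⟨ *-distribˡ-+ (suc Q ^ e) (sphere 1 r e) _ ⟩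
  suc Q ^ e * sphere 1 r e + suc Q ^ e * sphere 1 r e     ≡⟨ sym (cong₂ _+_ (sphere-scale (suc Q) r e) (sphere-scale (suc Q) r e)) ⟩
  sphere (suc Q) r e + sphere (suc Q) r e                 ∎
  where open ≤-Reasoning

ball-suc : ∀ Q r e → ball Q r (suc e) ≡ ball Q r e + sphere Q r e
ball-suc Q zero    zero    = refl
ball-suc Q zero    (suc e) = refl
ball-suc Q (suc r) zero    = cong₂ _+_ (ball-suc Q r zero) (*-zeroʳ Q)
ball-suc Q (suc r) (suc e) = trans (cong₂ (λ x y → x + Q * y) (ball-suc Q r (suc e)) (ball-suc Q r e))
  (regroup (ball Q r (suc e)) (sphere Q r (suc e)) (ball Q r e) (sphere Q r e) Q)
  where
  regroup : ∀ a b c d q → a + b + q * (c + d) ≡ a + q * c + (b + q * d)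
  regroup = solve-∀

-- Sums over all coefficient vectors and the bijections behind them

∑-mono : ∀ {n} {f g : Fin n → ℕ} → (∀ i → f i ≤ g i) → ∑ f ≤ ∑ g
∑-mono {zero}  h = z≤n
∑-mono {suc n} h = +-mono-≤ (h zero) (∑-mono (h ∘ suc))

∑-const : ∀ n c → ∑ {n} (λ _ → c) ≡ n * c
∑-const zero    c = refl
∑-const (suc n) c = cong (c +_) (∑-const n c)

∑ⱽ : ∀ {q} r → (Vec (Fin q) r → ℕ) → ℕ
∑ⱽ zero    f = f []
∑ⱽ (suc r) f = ∑ (λ y → ∑ⱽ r (λ x → f (y ∷ x)))

∑ⱽ-mono : ∀ {q} r {f g : Vec (Fin q) r → ℕ} → (∀ x → f x ≤ g x) → ∑ⱽ r f ≤ ∑ⱽ r g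
∑ⱽ-mono zero    h = h []
∑ⱽ-mono (suc r) h = ∑-mono (λ y → ∑ⱽ-mono r (λ x → h (y ∷ x)))

∑ⱽ-cong : ∀ {q} r {f g : Vec (Fin q) r → ℕ} → (∀ x → f x ≡ g x) → ∑ⱽ r f ≡ ∑ⱽ r g
∑ⱽ-cong zero    h = h []
∑ⱽ-cong (suc r) h = sum-cong-≗ (λ y → ∑ⱽ-cong r (λ x → h (y ∷ x)))

∑ⱽ-+ : ∀ {q} r (f g : Vec (Fin q) r → ℕ) → ∑ⱽ r (λ x → f x + g x) ≡ ∑ⱽ r f + ∑ⱽ r g
∑ⱽ-+ zero    f g = refl
∑ⱽ-+ (suc r) f g = trans (sum-cong-≗ (λ y → ∑ⱽ-+ r (f ∘ (y ∷_)) (g ∘ (y ∷_))))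
  (∑-distrib-+ (λ y → ∑ⱽ r (f ∘ (y ∷_))) (λ y → ∑ⱽ r (g ∘ (y ∷_))))

-- Fin (suc Q) codes the field elements, with zero for 0; so Q = q − 1.
wt : ∀ {Q r} → Vec (Fin (suc Q)) r → ℕ
wt []          = 0
wt (zero ∷ x)  = wt x
wt (suc _ ∷ x) = suc (wt x)

-- Indicators with values in ℕ. Structural recursion lets a nonzero leading entry cancel by
-- computation, so that sums of indicators follow the recursions of `sphere` and `ball`.
[_≡?_] [_<?_] : ℕ → ℕ → ℕ
[ zero  ≡? zero  ] = 1
[ zero  ≡? suc _ ] = 0
[ suc _ ≡? zero  ] = 0
[ suc m ≡? suc n ] = [ m ≡? n ]
[ _     <? zero  ] = 0
[ zero  <? suc _ ] = 1
[ suc m <? suc n ] = [ m <? n ]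

∑ⱽ-zero : ∀ {q} r → ∑ⱽ {q} r (λ _ → 0) ≡ 0
∑ⱽ-zero zero        = refl
∑ⱽ-zero {q} (suc r) = trans (sum-cong-≗ {n = q} (λ _ → ∑ⱽ-zero r)) (trans (∑-const q 0) (*-zeroʳ q))

∑ⱽ-sphere : ∀ Q r e → ∑ⱽ {suc Q} r (λ x → [ wt x ≡? e ]) ≡ sphere Q r e
∑ⱽ-sphere Q zero    zero    = refl
∑ⱽ-sphere Q zero    (suc e) = refl
∑ⱽ-sphere Q (suc r) zero    = cong₂ _+_ (∑ⱽ-sphere Q r zero)
  (trans (sum-cong-≗ {n = Q} (λ _ → ∑ⱽ-zero r)) (trans (∑-const Q 0) (*-zeroʳ Q)))
∑ⱽ-sphere Q (suc r) (suc e) = cong₂ _+_ (∑ⱽ-sphere Q r (suc e))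
  (trans (sum-cong-≗ {n = Q} (λ _ → ∑ⱽ-sphere Q r e)) (∑-const Q _))

∑ⱽ-ball : ∀ Q r e → ∑ⱽ {suc Q} r (λ x → [ wt x <? e ]) ≡ ball Q r e
∑ⱽ-ball Q r       zero    = trans (∑ⱽ-cong r (λ _ → refl)) (∑ⱽ-zero r)
∑ⱽ-ball Q zero    (suc e) = refl
∑ⱽ-ball Q (suc r) (suc e) = cong₂ _+_ (∑ⱽ-ball Q r (suc e))
  (trans (sum-cong-≗ {n = Q} (λ _ → ∑ⱽ-ball Q r e)) (∑-const Q _))

f≤∑ : ∀ {n} (f : Fin n → ℕ) i → f i ≤ ∑ f
f≤∑ f zero    = m≤m+n _ _
f≤∑ f (suc i) = ≤-trans (f≤∑ (f ∘ suc) i) (m≤n+m _ _)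

f+f≤∑ : ∀ {n} (f : Fin n → ℕ) {i j} → i ≢ j → f i + f j ≤ ∑ f
f+f≤∑ f {zero}  {zero}  i≢j = contradiction refl i≢j
f+f≤∑ f {zero}  {suc j} i≢j = +-monoʳ-≤ (f zero) (f≤∑ (f ∘ suc) j)
f+f≤∑ f {suc i} {zero}  i≢j = ≤-trans (≤-reflexive (+-comm (f (suc i)) (f zero)))
  (+-monoʳ-≤ (f zero) (f≤∑ (f ∘ suc) i))
f+f≤∑ f {suc i} {suc j} i≢j = ≤-trans (f+f≤∑ (f ∘ suc) (i≢j ∘ cong suc)) (m≤n+m _ _)

sgn : ℕ → ℕ
sgn zero    = 0
sgn (suc _) = 1

[j+1+m≡?]≤[j<?] : ∀ j m k → [ j + suc m ≡? k ] ≤ [ j <? k ]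
[j+1+m≡?]≤[j<?] zero    m zero    = z≤n
[j+1+m≡?]≤[j<?] (suc j) m zero    = z≤n
[j+1+m≡?]≤[j<?] zero    zero    (suc zero)    = ≤-refl
[j+1+m≡?]≤[j<?] zero    zero    (suc (suc k)) = z≤n
[j+1+m≡?]≤[j<?] zero    (suc m) (suc zero)    = z≤n
[j+1+m≡?]≤[j<?] zero    (suc m) (suc (suc k)) = [j+1+m≡?]≤[j<?] zero m (suc k)
[j+1+m≡?]≤[j<?] (suc j) m (suc k) = [j+1+m≡?]≤[j<?] j m k

-- Read j as wt x and m as wt (Ax). If m = 0, a hit means j = k. If m > 0, a hit needs j < k, while
-- j = k is a miss. Summed over x this is the whole balance of hits and misses.
[j+m≡?]-bound : ∀ j m k → [ j + m ≡? k ] + [ j ≡? k ] * sgn m ≤ [ j ≡? k ] + [ j <? k ]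
[j+m≡?]-bound j zero    k = begin
  [ j + 0 ≡? k ] + [ j ≡? k ] * 0   ≡⟨ cong₂ _+_ (cong [_≡? k ] (+-identityʳ j)) (*-zeroʳ [ j ≡? k ]) ⟩
  [ j ≡? k ] + 0                    ≤⟨ +-monoʳ-≤ [ j ≡? k ] z≤n ⟩
  [ j ≡? k ] + [ j <? k ]           ∎
  where open ≤-Reasoning
[j+m≡?]-bound j (suc m) k = begin
  [ j + suc m ≡? k ] + [ j ≡? k ] * 1   ≡⟨ cong ([ j + suc m ≡? k ] +_) (*-identityʳ [ j ≡? k ]) ⟩
  [ j + suc m ≡? k ] + [ j ≡? k ]       ≤⟨ +-monoˡ-≤ [ j ≡? k ] ([j+1+m≡?]≤[j<?] j m k) ⟩
  [ j <? k ] + [ j ≡? k ]               ≡⟨ +-comm [ j <? k ] [ j ≡? k ] ⟩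
  [ j ≡? k ] + [ j <? k ]               ∎
  where open ≤-Reasoning

-- Turns a numerical sum into a type of pairs, so that the same count can both bound an injection
-- and enumerate the vectors of a sphere.
∑↔ : ∀ {n} (f : Fin n → ℕ) → Fin (∑ f) ↔ ∃ (Fin ∘ f)
∑↔ {zero}  f = mk↔ₛ′ (λ ()) (λ ()) (λ ()) (λ ())
∑↔ {suc n} f = mk↔ₛ′ to from to∘from from∘to
  where
  module Head = Inverse (+↔⊎ {f zero} {∑ (f ∘ suc)})
  module Tail = Inverse (∑↔ (f ∘ suc))

  to⊎ : Fin (f zero) ⊎ Fin (∑ (f ∘ suc)) → ∃ (Fin ∘ f)
  to⊎ (inj₁ i) = zero , i
  to⊎ (inj₂ j) with i , k ← Tail.to j = suc i , k

  from⊎ : ∃ (Fin ∘ f) → Fin (f zero) ⊎ Fin (∑ (f ∘ suc))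
  from⊎ (zero  , i) = inj₁ i
  from⊎ (suc i , k) = inj₂ (Tail.from (i , k))

  to⊎∘from⊎ : ∀ p → to⊎ (from⊎ p) ≡ p
  to⊎∘from⊎ (zero  , i) = refl
  to⊎∘from⊎ (suc i , k) = cong (λ (i , k) → suc i , k) (Tail.inverseˡ refl)

  from⊎∘to⊎ : ∀ s → from⊎ (to⊎ s) ≡ s
  from⊎∘to⊎ (inj₁ i) = refl
  from⊎∘to⊎ (inj₂ j) = cong inj₂ (Tail.inverseʳ refl)

  to : Fin (∑ f) → ∃ (Fin ∘ f)
  to = to⊎ ∘ Head.to

  from : ∃ (Fin ∘ f) → Fin (∑ f)
  from = Head.from ∘ from⊎

  to∘from : ∀ p → to (from p) ≡ p
  to∘from p = trans (cong to⊎ (Head.inverseˡ {from⊎ p} refl)) (to⊎∘from⊎ p)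

  from∘to : ∀ i → from (to i) ≡ i
  from∘to i = trans (cong Head.from (from⊎∘to⊎ (Head.to i))) (Head.inverseʳ refl)

∑ⱽ↔ : ∀ {q} r (f : Vec (Fin q) r → ℕ) → Fin (∑ⱽ r f) ↔ ∃ (Fin ∘ f)
∑ⱽ↔ zero f = mk↔ₛ′ ([] ,_) (λ { ([] , i) → i }) (λ { ([] , i) → refl }) (λ _ → refl)
∑ⱽ↔ (suc r) f = mk↔ₛ′ to from to∘from from∘to
  where
  module Head = Inverse (∑↔ (λ y → ∑ⱽ r (f ∘ (y ∷_))))
  module Tail y = Inverse (∑ⱽ↔ r (f ∘ (y ∷_)))

  toᵗ : ∃ (λ y → Fin (∑ⱽ r (f ∘ (y ∷_)))) → ∃ (Fin ∘ f)
  toᵗ (y , j) = let x , k = Tail.to y j in y ∷ x , k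

  fromᵗ : ∃ (Fin ∘ f) → ∃ (λ y → Fin (∑ⱽ r (f ∘ (y ∷_))))
  fromᵗ (y ∷ x , k) = y , Tail.from y (x , k)

  to : Fin (∑ⱽ (suc r) f) → ∃ (Fin ∘ f)
  to = toᵗ ∘ Head.to

  from : ∃ (Fin ∘ f) → Fin (∑ⱽ (suc r) f)
  from = Head.from ∘ fromᵗ

  to∘from : ∀ p → to (from p) ≡ p
  to∘from p@(y ∷ x , k) = trans (cong toᵗ (Head.inverseˡ refl))
    (cong (λ (x , k) → y ∷ x , k) (Tail.inverseˡ y refl))

  from∘to : ∀ i → from (to i) ≡ i
  from∘to i = trans (cong (λ j → Head.from (proj₁ (Head.to i) , j)) (Tail.inverseʳ _ refl)) (Head.inverseʳ refl)

injection-≤-∑ⱽ : ∀ {q m} r (f : Vec (Fin q) r → ℕ) (x : Fin m → Vec (Fin q) r) →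
  (∀ i j → x i ≡ x j → i ≡ j) → (∀ i → f (x i) ≡ 1) → m ≤ ∑ⱽ r f
injection-≤-∑ⱽ {q} {m} r f x x-inj f≡1 = injective⇒≤ {f = Bij.from ∘ pt} λ {i} {j} eq →
  x-inj i j (cong proj₁ (trans (sym (Bij.inverseˡ refl)) (trans (cong Bij.to eq) (Bij.inverseˡ refl))))
  where
  module Bij = Inverse (∑ⱽ↔ r f)
  pt : Fin m → ∃ (Fin ∘ f)
  pt i = x i , subst Fin (sym (f≡1 i)) zero

[≡?]-refl : ∀ k → [ k ≡? k ] ≡ 1
[≡?]-refl zero    = refl
[≡?]-refl (suc k) = [≡?]-refl k

[≡?]-prop : ∀ j k (i i′ : Fin [ j ≡? k ]) → j ≡ k × i ≡ i′
[≡?]-prop zero    zero    zero zero = refl , refl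
[≡?]-prop (suc j) (suc k) i    i′   = let eq , eq′ = [≡?]-prop j k i i′ in cong suc eq , eq′

enumerate-sphere : ∀ Q r k → Σ (Fin (sphere Q r k) → Vec (Fin (suc Q)) r) λ x →
  (∀ i → wt (x i) ≡ k) × (∀ i j → x i ≡ x j → i ≡ j)
enumerate-sphere Q r k = subst
  (λ m → Σ (Fin m → Vec (Fin (suc Q)) r) λ x → (∀ i → wt (x i) ≡ k) × (∀ i j → x i ≡ x j → i ≡ j))
  (∑ⱽ-sphere Q r k)
  ( (λ i → proj₁ (Bij.to i))
  , (λ i → let x , j = Bij.to i in proj₁ ([≡?]-prop (wt x) k j j))
  , λ i j eq → trans (sym (Bij.inverseʳ refl)) (trans (cong Bij.from (pair-≡ eq)) (Bij.inverseʳ refl)))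
  where
  module Bij = Inverse (∑ⱽ↔ {suc Q} r (λ x → [ wt x ≡? k ]))
  pair-≡ : ∀ {p p′ : ∃ (λ (x : Vec (Fin (suc Q)) r) → Fin [ wt x ≡? k ])} → proj₁ p ≡ proj₁ p′ → p ≡ p′
  pair-≡ {x , i} {_ , i′} refl = cong (x ,_) (proj₂ ([≡?]-prop (wt x) k i i′))

-- Deletion of one occurrence of `a`. Bringing a chosen column to the front is the only reordering
-- that the proof performs.
data Pick {A : Set} (a : A) : ∀ {r} → Vec A (suc r) → Vec A r → Set where
  here  : ∀ {r} {as : Vec A r} → Pick a (a ∷ as) as
  there : ∀ {r b} {as : Vec A (suc r)} {bs : Vec A r} → Pick a as bs → Pick a (b ∷ as) (b ∷ bs)

-- Coding of the field, weights and linear combinations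

module Extremal (F : FiniteField) where
  open FiniteField F
    using ( Carrier; _≈_; 0#; 1#; 1≉0; inverse; q; enum; enum-injective; enum-surjective
          ; setoid; commutativeSemiring; +-rawMonoid; -‿inverseˡ; zeroʳ; zeroˡ; distribʳ)
    renaming ( _+_ to _⊕_; _*_ to _⊗_; -_ to ⊖_
             ; refl to ≈-refl; sym to ≈-sym; trans to ≈-trans; reflexive to ≈-reflexive
             ; +-cong to ⊕-cong; +-congˡ to ⊕-congˡ; +-congʳ to ⊕-congʳ
             ; +-identityˡ to ⊕-identityˡ; +-identityʳ to ⊕-identityʳ
             ; *-cong to ⊗-cong; *-congˡ to ⊗-congˡ; *-congʳ to ⊗-congʳ
             ; *-identityˡ to ⊗-identityˡ; *-identityʳ to ⊗-identityʳ
             ; *-assoc to ⊗-assoc; *-comm to ⊗-comm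
             ; +-commutativeSemigroup to ⊕-commutativeSemigroup; +-group to ⊕-group)
  open RawMonoidDefs +-rawMonoid using (sum)
  open import Algebra.Properties.Group ⊕-group using () renaming (∙-cancelʳ to ⊕-cancelʳ)
  open import Algebra.Properties.CommutativeSemigroup ⊕-commutativeSemigroup
    using () renaming (x∙yz≈y∙xz to ⊕-exchange)
  open SemiringSolver commutativeSemiring using (solve; _:+_; _:*_; _:=_; con)
  module ≈-Reasoning = SetoidReasoning setoid

  index : Carrier → Fin q
  index x = proj₁ (enum-surjective x)

  infix 4 _≈?_
  _≈?_ : ∀ x y → Dec (x ≈ y)
  x ≈? y = map′
    (λ eq → ≈-trans (≈-sym (proj₂ (enum-surjective x)))
      (≈-trans (≈-reflexive (cong enum eq)) (proj₂ (enum-surjective y))))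
    (λ x≈y → enum-injective _ _
      (≈-trans (proj₂ (enum-surjective x)) (≈-trans x≈y (≈-sym (proj₂ (enum-surjective y))))))
    (index x Fin.≟ index y)

  -- `enum` may list 0 anywhere; here it comes first, so weights can be read off by pattern
  -- matching. Codes also give each field element a unique representative, which lets vectors be
  -- counted up to propositional equality although the field is a setoid.
  record Coding : Set where
    field
      Q       : ℕ
      q≡1+Q   : q ≡ suc Q
      el      : Fin (suc Q) → Carrier
      el-zero : el zero ≈ 0#
      el-suc  : ∀ i → ¬ el (suc i) ≈ 0#
      el-injective : ∀ {i j} → el i ≈ el j → i ≡ j
      code    : Carrier → Fin (suc Q)
      el-code : ∀ x → el (code x) ≈ x

    code-cong : ∀ {x y} → x ≈ y → code x ≡ code y
    code-cong {x} {y} x≈y = el-injective (≈-trans (el-code x) (≈-trans x≈y (≈-sym (el-code y))))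

  coding : Coding
  coding = zero-first q enum enum-injective enum-surjective refl
    where
    zero-first : ∀ n (e : Fin n → Carrier) → (∀ i j → e i ≈ e j → i ≡ j) → (∀ x → ∃ λ i → e i ≈ x) →
      q ≡ n → Coding
    zero-first zero    e e-inj e-surj eq with () ← proj₁ (e-surj 0#)
    zero-first (suc Q) e e-inj e-surj eq = record
      { Q = Q ; q≡1+Q = eq ; el = el ; el-zero = ≈-refl ; el-suc = el-suc
      ; el-injective = el-inj _ _
      ; code = λ x → proj₁ (el-surj x) ; el-code = λ x → proj₂ (el-surj x) }
      where
      z : Fin (suc Q)
      z = proj₁ (e-surj 0#)
      el : Fin (suc Q) → Carrier
      el zero    = 0#
      el (suc i) = e (punchIn z i)
      el-suc : ∀ i → ¬ el (suc i) ≈ 0#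
      el-suc i eq = punchInᵢ≢i z i (e-inj _ _ (≈-trans eq (≈-sym (proj₂ (e-surj 0#)))))
      el-inj : ∀ i j → el i ≈ el j → i ≡ j
      el-inj zero    zero    eq = refl
      el-inj zero    (suc j) eq = contradiction (≈-sym eq) (el-suc j)
      el-inj (suc i) zero    eq = contradiction eq (el-suc i)
      el-inj (suc i) (suc j) eq = cong suc (punchIn-injective z i j (e-inj _ _ eq))
      el-surj : ∀ x → ∃ λ i → el i ≈ x
      el-surj x with z Fin.≟ proj₁ (e-surj x)
      ... | yes eq = zero , ≈-trans (≈-sym (proj₂ (e-surj 0#))) (≈-trans (≈-reflexive (cong e eq)) (proj₂ (e-surj x)))
      ... | no neq = suc (punchOut neq) , ≈-trans (≈-reflexive (cong e (punchIn-punchOut neq))) (proj₂ (e-surj x))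

  open Coding coding public

  el-code-≉0 : ∀ {x i} → code x ≡ suc i → ¬ x ≈ 0#
  el-code-≉0 {x} {i} eq x≈0 = el-suc i (≈-trans (≈-reflexive (cong el (sym eq))) (≈-trans (el-code x) x≈0))

  el-code-≈0 : ∀ {x} → code x ≡ zero → x ≈ 0#
  el-code-≈0 {x} eq = ≈-trans (≈-sym (el-code x)) (≈-trans (≈-reflexive (cong el eq)) el-zero)

  ν : Carrier → ℕ
  ν x = wt (code x ∷ [])

  ν-zero : ∀ {x} → x ≈ 0# → ν x ≡ 0
  ν-zero {x} x≈0 with code x in eq
  ... | zero  = refl
  ... | suc i = contradiction x≈0 (el-code-≉0 eq)

  ν-nonzero : ∀ {x} → ¬ x ≈ 0# → ν x ≡ 1
  ν-nonzero {x} x≉0 with code x in eq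
  ... | zero  = contradiction (el-code-≈0 eq) x≉0
  ... | suc i = refl

  ν≡0⇒≈0 : ∀ {x} → ν x ≡ 0 → x ≈ 0#
  ν≡0⇒≈0 {x} h with code x in eq
  ... | zero = el-code-≈0 eq

  ν-cong : ∀ {x y} → x ≈ y → ν x ≡ ν y
  ν-cong x≈y = cong (λ c → wt (c ∷ [])) (code-cong x≈y)

  wt-∷ : ∀ {r} y (x : Vec (Fin (suc Q)) r) → wt (y ∷ x) ≡ wt (y ∷ []) + wt x
  wt-∷ zero    x = refl
  wt-∷ (suc y) x = refl

  V : ℕ → Set
  V = Vec𝔽 F

  infix 4 _≋_
  _≋_ : ∀ {n} → V n → V n → Set
  u ≋ v = ∀ t → u t ≈ v t

  _≋?_ : ∀ {n} (u v : V n) → Dec (u ≋ v)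
  u ≋? v = all? (λ t → u t ≈? v t)

  0ⱽ : ∀ {n} → V n
  0ⱽ _ = 0#

  infixl 6 _⊞_
  infixl 7 _·_
  _⊞_ : ∀ {n} → V n → V n → V n
  (u ⊞ v) t = u t ⊕ v t
  _·_ : ∀ {n} → Carrier → V n → V n
  (c · v) t = c ⊗ v t

  ω : ∀ {n} → V n → ℕ
  ω v = ∑ (ν ∘ v)

  ω-cong : ∀ {n} {u v : V n} → u ≋ v → ω u ≡ ω v
  ω-cong u≋v = sum-cong-≗ (λ t → ν-cong (u≋v t))

  ω-zero : ∀ {n} {v : V n} → v ≋ 0ⱽ → ω v ≡ 0
  ω-zero {zero}  v≋0 = refl
  ω-zero {suc n} v≋0 = cong₂ _+_ (ν-zero (v≋0 zero)) (ω-zero (v≋0 ∘ suc))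

  ω≡0⇒≋0 : ∀ {n} {v : V n} → ω v ≡ 0 → v ≋ 0ⱽ
  ω≡0⇒≋0 {suc n} {v} h zero    = ν≡0⇒≈0 (m+n≡0⇒m≡0 (ν (v zero)) h)
  ω≡0⇒≋0 {suc n} {v} h (suc t) = ω≡0⇒≋0 (m+n≡0⇒n≡0 (ν (v zero)) h) t

  HasWeight⇒ω : ∀ {n k} {v : V n} → HasWeight F v k → ω v ≡ k
  HasWeight⇒ω (S , refl , S⇔) = ω≡∣S∣ S _ S⇔
    where
    tail⇔ : ∀ {n b} {S : Subset n} {v : V (suc n)} → (∀ i → (i ∈ₛ b ∷ S) ⇔ (¬ (v i ≈ 0#))) →
      ∀ i → (i ∈ₛ S) ⇔ (¬ (v (suc i) ≈ 0#))
    tail⇔ S⇔ i = mk⇔ (Equivalence.to (S⇔ (suc i)) ∘ there) (drop-there ∘ Equivalence.from (S⇔ (suc i)))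

    ω≡∣S∣ : ∀ {n} (S : Subset n) (v : V n) → (∀ i → (i ∈ₛ S) ⇔ (¬ (v i ≈ 0#))) → ω v ≡ ∣ S ∣
    ω≡∣S∣ []            v S⇔ = refl
    ω≡∣S∣ (inside  ∷ S) v S⇔ = cong₂ _+_ (ν-nonzero (Equivalence.to (S⇔ zero) here)) (ω≡∣S∣ S (v ∘ suc) (tail⇔ S⇔))
    ω≡∣S∣ (outside ∷ S) v S⇔ = cong₂ _+_
      (ν-zero (decidable-stable (v zero ≈? 0#) (λ v₀≉0 → contradiction (Equivalence.from (S⇔ zero) v₀≉0) λ ())))
      (ω≡∣S∣ S (v ∘ suc) (tail⇔ S⇔))

  -- A zero coefficient skips its column instead of adding a zero multiple; this makes `Φ-∷` hold by
  -- computation.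
  comb : ∀ {n r} → Vec (Fin (suc Q)) r → Vec (V n) r → V n
  comb []          []       = 0ⱽ
  comb (zero ∷ x)  (a ∷ as) = comb x as
  comb (suc i ∷ x) (a ∷ as) = el (suc i) · a ⊞ comb x as

  comb-∷ : ∀ {n r} y x (a : V n) (as : Vec (V n) r) → comb (y ∷ x) (a ∷ as) ≋ el y · a ⊞ comb x as
  comb-∷ zero    x a as t = ≈-sym (≈-trans (⊕-congʳ (≈-trans (⊗-congʳ el-zero) (zeroˡ (a t)))) (⊕-identityˡ _))
  comb-∷ (suc i) x a as t = ≈-refl

  -- Pivot coordinates are zeroed rather than deleted, so that all elimination maps stay
  -- endomorphisms of `V n`.
  mask : ∀ {n} → Fin n → V n
  mask t = updateAt (const 1#) t (const 0#)

  ω-split : ∀ {n} (t : Fin n) (v : V n) → ω v ≡ ν (v t) + ω (λ s → mask t s ⊗ v s)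
  ω-split zero v = cong (ν (v zero) +_) (trans
    (ω-cong (λ s → ≈-sym (⊗-identityˡ (v (suc s)))))
    (cong (_+ ω (λ s → 1# ⊗ v (suc s))) (sym (ν-zero (zeroˡ (v zero))))))
  ω-split (suc t) v = begin
    ν (v zero) + ω (v ∘ suc)
      ≡⟨ cong₂ _+_ (ν-cong (≈-sym (⊗-identityˡ (v zero)))) (ω-split t (v ∘ suc)) ⟩
    ν (1# ⊗ v zero) + (ν (v (suc t)) + ω (λ s → mask t s ⊗ v (suc s)))
      ≡⟨ exchange (ν (1# ⊗ v zero)) (ν (v (suc t))) _ ⟩
    ν (v (suc t)) + (ν (1# ⊗ v zero) + ω (λ s → mask t s ⊗ v (suc s))) ∎
    where
    open ≡-Reasoning
    exchange : ∀ a b c → a + (b + c) ≡ b + (a + c)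
    exchange = solve-∀

  -- Systematic form by Gaussian elimination

  record IsLinear {n} (M : V n → V n) : Set where
    field
      M-cong  : ∀ {u v} → u ≋ v → M u ≋ M v
      M-zero  : M 0ⱽ ≋ 0ⱽ
      M-+·    : ∀ u c v → M (c · u ⊞ v) ≋ c · M u ⊞ M v

  comb-map : ∀ {n r} {M : V n → V n} → IsLinear M → ∀ x (as : Vec (V n) r) →
    comb x (map M as) ≋ M (comb x as)
  comb-map L []          []       t = ≈-sym (IsLinear.M-zero L t)
  comb-map L (zero ∷ x)  (a ∷ as) t = comb-map L x as t
  comb-map L (suc i ∷ x) (a ∷ as) t = ≈-trans (⊕-congˡ (comb-map L x as t)) (≈-sym (IsLinear.M-+· L a (el (suc i)) (comb x as) t))

  -- φ selects entries of a vector of u + span cols (padded with zeros if cols are dependent);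
  -- its other entries are the affine function M u + comb φ cols′ of these.  The offset u is
  -- what makes the induction on cols go through.
  record Systematic {n r} (cols : Vec (V n) r) : Set where
    field
      M        : V n → V n
      M-linear : IsLinear M
      cols′    : Vec (V n) r
      φ        : V n → Vec (Fin (suc Q)) r → Vec (Fin (suc Q)) r
    rest : V n → Vec (Fin (suc Q)) r → V n
    rest u x = M u ⊞ comb (φ u x) cols′
    field
      weight   : ∀ u x → ω (u ⊞ comb x cols) ≡ wt (φ u x) + ω (rest u x)
      recover  : ∀ u u′ x x′ → φ u x ≡ φ u′ x′ → rest u x ≋ rest u′ x′ →
                 u ⊞ comb x cols ≋ u′ ⊞ comb x′ cols

  module _ {n r} {cols : Vec (V n) r} (S : Systematic cols) (b₀ : V n) where
    open Systematic S
    open IsLinear M-linear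

    private
      b : V n
      b = M b₀

      -- The new column is moved, with its coefficient, into the offset, where the systematic form
      -- of `cols` can handle it.
      u₁ : V n → Fin (suc Q) → V n
      u₁ u y = el y · b₀ ⊞ u

      absorb : ∀ u y x → u ⊞ comb (y ∷ x) (b₀ ∷ cols) ≋ u₁ u y ⊞ comb x cols
      absorb u y x t = ≈-trans (⊕-congˡ (comb-∷ y x b₀ cols t))
        (solve 3 (λ a b c → a :+ (b :+ c) := (b :+ a) :+ c) ≈-refl (u t) (el y ⊗ b₀ t) (comb x cols t))

    -- If `b₀` reduces to zero, the coefficient y leaves no trace outside the existing pivots: there
    -- is no new pivot, and the new slot is padded with zero. Such coefficients cannot be read back,
    -- which is why `recover` concludes equality of vectors and not of coefficients.
    extend-zero : b ≋ 0ⱽ → Systematic (b₀ ∷ cols)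
    extend-zero b≋0 = record
      { M = M ; M-linear = M-linear ; cols′ = 0ⱽ ∷ cols′
      ; φ = φ₀
      ; weight = λ { u (y ∷ x) → trans (ω-cong (absorb u y x)) (trans (weight (u₁ u y) x)
          (cong (wt (φ (u₁ u y) x) +_) (ω-cong (rest≋ u y x)))) }
      ; recover = λ { u u′ (y ∷ x) (y′ ∷ x′) φ≡ rest≋′ t → ≈-trans (absorb u y x t) (≈-trans
          (recover (u₁ u y) (u₁ u′ y′) x x′ (proj₂ (∷-injective φ≡))
            (λ s → ≈-trans (rest≋ u y x s) (≈-trans (rest≋′ s) (≈-sym (rest≋ u′ y′ x′ s)))) t)
          (≈-sym (absorb u′ y′ x′ t))) } }
      where
      φ₀ : V n → Vec (Fin (suc Q)) (suc r) → Vec (Fin (suc Q)) (suc r)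
      φ₀ u (y ∷ x) = zero ∷ φ (u₁ u y) x
      rest≋ : ∀ u y x → rest (u₁ u y) x ≋ M u ⊞ comb (φ (u₁ u y) x) cols′
      rest≋ u y x t = ⊕-congʳ (≈-trans (M-+· b₀ (el y) u t)
        (≈-trans (⊕-congʳ (≈-trans (⊗-congˡ (b≋0 t)) (zeroʳ (el y)))) (⊕-identityˡ (M u t))))

    module _ (p : Fin n) (c : Carrier) (bc≈1 : b p ⊗ c ≈ 1#) where
      private
        m β : V n
        m = mask p
        β t = ⊖ (c ⊗ b t)

        -- Elimination with pivot p: `D` kills `b` because `b p ⊗ c ≈ 1#`, and off p every w equals
        -- `D w` plus `w p` times `c · b`. So y survives only through the entry at p, and `φ₁`
        -- records that entry in place of y, with masked `c · b` as its column.
        D : V n → V n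
        D w t = m t ⊗ (w t ⊕ w p ⊗ β t)

        D-linear : IsLinear D
        D-linear = record
          { M-cong = λ u≋v t → ⊗-congˡ (⊕-cong (u≋v t) (⊗-congʳ (u≋v p)))
          ; M-zero = λ t → solve 2 (λ m β → m :* (con 0 :+ con 0 :* β) := con 0) ≈-refl (m t) (β t)
          ; M-+·   = λ u c v t → solve 7
              (λ m β c ut up vt vp → m :* ((c :* ut :+ vt) :+ (c :* up :+ vp) :* β)
                 := c :* (m :* (ut :+ up :* β)) :+ m :* (vt :+ vp :* β))
              ≈-refl (m t) (β t) c (u t) (u p) (v t) (v p) }

        φ₁ : V n → Vec (Fin (suc Q)) (suc r) → Vec (Fin (suc Q)) (suc r)
        φ₁ u (y ∷ x) = code (rest (u₁ u y) x p) ∷ φ (u₁ u y) x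

        cols₁ : Vec (V n) (suc r)
        cols₁ = (λ t → m t ⊗ (c ⊗ b t)) ∷ map D cols′

        rest₁ : V n → Vec (Fin (suc Q)) (suc r) → V n
        rest₁ u x = D (M u) ⊞ comb (φ₁ u x) cols₁

        rest≋ : ∀ u y x → rest₁ u (y ∷ x) ≋ (λ t → m t ⊗ rest (u₁ u y) x t)
        rest≋ u y x t = begin
          D (M u) t ⊕ comb (code v₁p ∷ xs) cols₁ t
            ≈⟨ ⊕-congˡ (comb-∷ (code v₁p) xs _ _ t) ⟩
          D (M u) t ⊕ (el (code v₁p) ⊗ (m t ⊗ (c ⊗ b t)) ⊕ comb xs (map D cols′) t)
            ≈⟨ ⊕-congˡ (⊕-cong (⊗-congʳ (≈-trans (el-code v₁p) (v₁≈ p))) (comb-map D-linear xs cols′ t)) ⟩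
          D (M u) t ⊕ ((el y ⊗ b p ⊕ M u p ⊕ w p) ⊗ (m t ⊗ (c ⊗ b t)) ⊕ D w t)
            -- The solver knows neither negation nor `bc≈1`. The right side therefore displays
            -- `b p ⊗ c` and `β t ⊕ c ⊗ b t`, which the next step replaces by 1 and 0.
            ≈⟨ solve 10 (λ m β c y bp bt Mup Mut wp wt →
                 m :* (Mut :+ Mup :* β) :+ ((y :* bp :+ Mup :+ wp) :* (m :* (c :* bt)) :+ m :* (wt :+ wp :* β))
                 := m :* (y :* ((bp :* c) :* bt) :+ Mut :+ wt) :+ m :* ((Mup :+ wp) :* (β :+ c :* bt)))
               ≈-refl (m t) (β t) c (el y) (b p) (b t) (M u p) (M u t) (w p) (w t) ⟩
          m t ⊗ (el y ⊗ ((b p ⊗ c) ⊗ b t) ⊕ M u t ⊕ w t) ⊕ m t ⊗ ((M u p ⊕ w p) ⊗ (β t ⊕ c ⊗ b t))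
            ≈⟨ ⊕-cong (⊗-congˡ (⊕-congʳ (⊕-congʳ (⊗-congˡ (≈-trans (⊗-congʳ bc≈1) (⊗-identityˡ (b t)))))))
                      (≈-trans (⊗-congˡ (≈-trans (⊗-congˡ (-‿inverseˡ (c ⊗ b t))) (zeroʳ _))) (zeroʳ (m t))) ⟩
          m t ⊗ (el y ⊗ b t ⊕ M u t ⊕ w t) ⊕ 0#
            ≈⟨ ⊕-identityʳ _ ⟩
          m t ⊗ (el y ⊗ b t ⊕ M u t ⊕ w t)
            ≈⟨ ⊗-congˡ (≈-sym (v₁≈ t)) ⟩
          m t ⊗ rest (u₁ u y) x t ∎
          where
          open ≈-Reasoning
          v₁p = rest (u₁ u y) x p
          xs  = φ (u₁ u y) x
          w   = comb xs cols′
          v₁≈ : ∀ s → rest (u₁ u y) x s ≈ el y ⊗ b s ⊕ M u s ⊕ w s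
          v₁≈ s = ⊕-congʳ (M-+· b₀ (el y) u s)

        weight₁ : ∀ u x → ω (u ⊞ comb x (b₀ ∷ cols)) ≡ wt (φ₁ u x) + ω (rest₁ u x)
        weight₁ u (y ∷ x) = begin
          ω (u ⊞ comb (y ∷ x) (b₀ ∷ cols))       ≡⟨ ω-cong (absorb u y x) ⟩
          ω (u₁ u y ⊞ comb x cols)               ≡⟨ weight (u₁ u y) x ⟩
          wt xs + ω v₁                           ≡⟨ cong (wt xs +_) (ω-split p v₁) ⟩
          wt xs + (ν (v₁ p) + ω (λ s → m s ⊗ v₁ s))
            ≡⟨ exchange (wt xs) (ν (v₁ p)) _ ⟩
          ν (v₁ p) + wt xs + ω (λ s → m s ⊗ v₁ s)
            ≡⟨ cong₂ _+_ (sym (wt-∷ (code (v₁ p)) xs)) (sym (ω-cong (rest≋ u y x))) ⟩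
          wt (φ₁ u (y ∷ x)) + ω (rest₁ u (y ∷ x)) ∎
          where
          open ≡-Reasoning
          xs = φ (u₁ u y) x
          v₁ = rest (u₁ u y) x
          exchange : ∀ a b c → a + (b + c) ≡ b + a + c
          exchange = solve-∀

        recover₁ : ∀ u u′ x x′ → φ₁ u x ≡ φ₁ u′ x′ → rest₁ u x ≋ rest₁ u′ x′ →
          u ⊞ comb x (b₀ ∷ cols) ≋ u′ ⊞ comb x′ (b₀ ∷ cols)
        recover₁ u u′ (y ∷ x) (y′ ∷ x′) φ≡ h t = ≈-trans (absorb u y x t) (≈-trans
          (recover (u₁ u y) (u₁ u′ y′) x x′ (proj₂ (∷-injective φ≡)) v₁≋v₁′ t)
          (≈-sym (absorb u′ y′ x′ t)))
          where
          v₁≋v₁′ : rest (u₁ u y) x ≋ rest (u₁ u′ y′) x′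
          -- The pivot entry is stored as the first entry of `φ₁`; all other entries survive the
          -- mask.
          v₁≋v₁′ s with s Fin.≟ p
          ... | yes refl = ≈-trans (≈-sym (el-code _))
                  (≈-trans (≈-reflexive (cong el (proj₁ (∷-injective φ≡)))) (el-code _))
          ... | no s≢p = begin
            rest (u₁ u y) x s           ≈⟨ unmask _ ⟩
            m s ⊗ rest (u₁ u y) x s     ≈⟨ ≈-sym (rest≋ u y x s) ⟩
            rest₁ u (y ∷ x) s           ≈⟨ h s ⟩
            rest₁ u′ (y′ ∷ x′) s        ≈⟨ rest≋ u′ y′ x′ s ⟩
            m s ⊗ rest (u₁ u′ y′) x′ s  ≈⟨ ≈-sym (unmask _) ⟩
            rest (u₁ u′ y′) x′ s        ∎
            where
            open ≈-Reasoning
            unmask : ∀ z → z ≈ m s ⊗ z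
            unmask z = ≈-sym (≈-trans (⊗-congʳ (≈-reflexive (updateAt-minimal s p (const 1#) s≢p))) (⊗-identityˡ z))

      extend-pivot : Systematic (b₀ ∷ cols)
      extend-pivot = record
        { M = D ∘ M
        ; M-linear = record
          { M-cong = IsLinear.M-cong D-linear ∘ M-cong
          ; M-zero = λ t → ≈-trans (IsLinear.M-cong D-linear M-zero t) (IsLinear.M-zero D-linear t)
          ; M-+·   = λ u c v t → ≈-trans (IsLinear.M-cong D-linear (M-+· u c v) t) (IsLinear.M-+· D-linear (M u) c (M v) t) }
        ; cols′ = cols₁ ; φ = φ₁ ; weight = weight₁ ; recover = recover₁ }

  systematic : ∀ {n r} (cols : Vec (V n) r) → Systematic cols
  systematic [] = record
    { M = id ; M-linear = record { M-cong = id ; M-zero = λ _ → ≈-refl ; M-+· = λ _ _ _ _ → ≈-refl }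
    ; cols′ = [] ; φ = λ _ x → x
    ; weight = λ { u [] → refl } ; recover = λ { u u′ [] [] _ h → h } }
  systematic {n} (b₀ ∷ cols) with S ← systematic cols with Systematic.M S b₀ ≋? 0ⱽ
  ... | yes b≋0 = extend-zero S b₀ b≋0
  ... | no  b≋̸0 with p , bp≉0 ← ¬∀⟶∃¬ n _ (λ t → Systematic.M S b₀ t ≈? 0#) b≋̸0
                 with c , bc≈1 ← inverse _ bp≉0 = extend-pivot S b₀ p c bc≈1

  -- Sums of functions of wt x and Ax, and reordering of columns

  Statistic : ℕ → Set
  Statistic n = ℕ → V n → ℕ

  Respects≋ : ∀ {n} → Statistic n → Set
  Respects≋ h = ∀ j {v w} → v ≋ w → h j v ≡ h j w

  Φ : ∀ {n r} → Statistic n → Vec (V n) r → ℕ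
  Φ {r = r} h cols = ∑ⱽ r (λ x → h (wt x) (comb x cols))

  Φ-cong : ∀ {n r} {h h′ : Statistic n} → (∀ j v → h j v ≡ h′ j v) → (cols : Vec (V n) r) → Φ h cols ≡ Φ h′ cols
  Φ-cong {r = r} eq cols = ∑ⱽ-cong r (λ x → eq (wt x) (comb x cols))

  -- The statistic that the remaining columns see once column `a` has received coefficient `y`.
  -- Arbitrary statistics are allowed so that induction on the columns stays within the same class
  -- of sums.
  after : ∀ {n} → Fin (suc Q) → V n → Statistic n → Statistic n
  after zero    a h j v = h j v
  after (suc i) a h j v = h (suc j) (el (suc i) · a ⊞ v)

  after-≋ : ∀ {n} y (a : V n) {h} → Respects≋ h → Respects≋ (after y a h)
  after-≋ zero    a resp j eq = resp j eq
  after-≋ (suc i) a resp j eq = resp (suc j) (λ t → ⊕-congˡ (eq t))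

  Φ-∷ : ∀ {n r} (h : Statistic n) a (cols : Vec (V n) r) → Φ h (a ∷ cols) ≡ ∑ (λ y → Φ (after y a h) cols)
  Φ-∷ {r = r} h a cols = sum-cong-≗ (split r cols)
    where
    split : ∀ r (cols : Vec (V _) r) y →
      ∑ⱽ r (λ x → h (wt (y ∷ x)) (comb (y ∷ x) (a ∷ cols))) ≡ Φ (after y a h) cols
    split r cols zero    = refl
    split r cols (suc i) = refl

  after-swap : ∀ {n} y z (a b : V n) {h} → Respects≋ h → ∀ j v → after y a (after z b h) j v ≡ after z b (after y a h) j v
  after-swap zero    zero    a b resp j v = refl
  after-swap zero    (suc _) a b resp j v = refl
  after-swap (suc _) zero    a b resp j v = refl
  after-swap (suc y) (suc z) a b resp j v = resp (2 + j) (λ t → ⊕-exchange _ _ _)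

  -- Swapping two adjacent columns interchanges the sums over their two coefficients. The order of
  -- addition then differs, which `h` ignores only because it respects `≋`.
  Φ-Pick : ∀ {n r h a} {as : Vec (V n) (suc r)} {bs} → Respects≋ h → Pick a as bs → Φ h as ≡ Φ h (a ∷ bs)
  Φ-Pick resp here = refl
  Φ-Pick {h = h} {a} {b ∷ as} {b ∷ bs} resp (there p) = begin
    Φ h (b ∷ as)                                                  ≡⟨ Φ-∷ h b as ⟩
    ∑ (λ y → Φ (after y b h) as)                                  ≡⟨ sum-cong-≗ (λ y → Φ-Pick (after-≋ y b resp) p) ⟩
    ∑ (λ y → Φ (after y b h) (a ∷ bs))                            ≡⟨ sum-cong-≗ (λ y → Φ-∷ (after y b h) a bs) ⟩
    ∑ (λ y → ∑ (λ z → Φ (after z a (after y b h)) bs))            ≡⟨ ∑-comm (λ y z → Φ (after z a (after y b h)) bs) ⟩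
    ∑ (λ z → ∑ (λ y → Φ (after z a (after y b h)) bs))            ≡⟨ sum-cong-≗ (λ z → sum-cong-≗ (λ y → Φ-cong (after-swap z y a b resp) bs)) ⟩
    ∑ (λ z → ∑ (λ y → Φ (after y b (after z a h)) bs))            ≡⟨ sum-cong-≗ (λ z → sym (Φ-∷ (after z a h) b bs)) ⟩
    ∑ (λ z → Φ (after z a h) (b ∷ bs))                            ≡⟨ sym (Φ-∷ h a (b ∷ bs)) ⟩
    Φ h (a ∷ b ∷ bs)                                              ∎
    where open ≡-Reasoning

  infix 4 _≃_
  -- Equality of all statistics instead of a permutation: it is all that the counting needs of a
  -- reordering.
  record _≃_ {n r} (as bs : Vec (V n) r) : Set where
    constructor mk≃
    field Φ-≡ : ∀ {h} → Respects≋ h → Φ h as ≡ Φ h bs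
  open _≃_ public

  ≃-trans : ∀ {n r} {as bs cs : Vec (V n) r} → as ≃ bs → bs ≃ cs → as ≃ cs
  ≃-trans p p′ = mk≃ λ resp → trans (Φ-≡ p resp) (Φ-≡ p′ resp)

  ≃-prep : ∀ {n r} a {as bs : Vec (V n) r} → as ≃ bs → a ∷ as ≃ a ∷ bs
  ≃-prep a {as} {bs} p = mk≃ λ {h} resp → trans (Φ-∷ h a as)
    (trans (sum-cong-≗ (λ y → Φ-≡ p (after-≋ y a resp))) (sym (Φ-∷ h a bs)))

  ≃-pick : ∀ {n r} {a} {as : Vec (V n) (suc r)} {bs} → Pick a as bs → as ≃ a ∷ bs
  ≃-pick p = mk≃ λ resp → Φ-Pick resp p

  find≋̸ : ∀ {n r} (b : V n) (cols : Vec (V n) (suc r)) →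
    All (_≋ b) cols ⊎ Σ (V n) λ a → Σ (Vec (V n) r) λ cols′ → ¬ a ≋ b × Pick a cols cols′
  find≋̸ b (a ∷ cols) with a ≋? b
  ... | no a≋̸b = inj₂ (a , cols , a≋̸b , here)
  find≋̸ b (a ∷ []) | yes a≋b = inj₁ (a≋b ∷ [])
  find≋̸ b (a ∷ cols@(_ ∷ _)) | yes a≋b with find≋̸ b cols
  ... | inj₁ cols≋b = inj₁ (a≋b ∷ cols≋b)
  ... | inj₂ (c , cols′ , c≋̸b , p) = inj₂ (c , a ∷ cols′ , c≋̸b , there p)

  -- Hits and misses

  hits misses : ∀ {n} → ℕ → Statistic n
  hits   k j v = [ j + ω v ≡? k ]
  misses k j v = [ j ≡? k ] * sgn (ω v)

  cnt mis : ∀ {n r} → ℕ → Vec (V n) r → ℕ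
  cnt k = Φ (hits k)
  mis k = Φ (misses k)

  hits-≋ : ∀ {n} k → Respects≋ {n} (hits k)
  hits-≋ k j v≋w = cong (λ m → [ j + m ≡? k ]) (ω-cong v≋w)

  misses-≋ : ∀ {n} k → Respects≋ {n} (misses k)
  misses-≋ k j v≋w = cong (λ m → [ j ≡? k ] * sgn m) (ω-cong v≋w)

  cnt-≃ : ∀ {n r} k {as bs : Vec (V n) r} → as ≃ bs → cnt k as ≡ cnt k bs
  cnt-≃ k p = Φ-≡ p (hits-≋ k)

  mis-≃ : ∀ {n r} k {as bs : Vec (V n) r} → as ≃ bs → mis k as ≡ mis k bs
  mis-≃ k p = Φ-≡ p (misses-≋ k)

  cnt+mis≤ : ∀ {n r} k (cols : Vec (V n) r) → cnt k cols + mis k cols ≤ sphere Q r k + ball Q r k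
  cnt+mis≤ {r = r} k cols = begin
    cnt k cols + mis k cols
      ≡⟨ sym (∑ⱽ-+ r _ _) ⟩
    ∑ⱽ r (λ x → hits k (wt x) (comb x cols) + misses k (wt x) (comb x cols))
      ≤⟨ ∑ⱽ-mono r (λ x → [j+m≡?]-bound (wt x) (ω (comb x cols)) k) ⟩
    ∑ⱽ r (λ x → [ wt x ≡? k ] + [ wt x <? k ])
      ≡⟨ ∑ⱽ-+ r _ _ ⟩
    ∑ⱽ r (λ x → [ wt x ≡? k ]) + ∑ⱽ r (λ x → [ wt x <? k ])
      ≡⟨ cong₂ _+_ (∑ⱽ-sphere Q r k) (∑ⱽ-ball Q r k) ⟩
    sphere Q r k + ball Q r k ∎
    where open ≤-Reasoning

  cnt≤sphere : ∀ {n r} k (cols : Vec (V n) r) → ball Q r k ≤ mis k cols → cnt k cols ≤ sphere Q r k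
  cnt≤sphere {r = r} k cols h = +-cancelʳ-≤ (mis k cols) _ _
    (≤-trans (cnt+mis≤ k cols) (+-monoʳ-≤ (sphere Q r k) h))

  comb-zero : ∀ {n r} {cols : Vec (V n) r} → All (_≋ 0ⱽ) cols → ∀ x → comb x cols ≋ 0ⱽ
  comb-zero []         []          t = ≈-refl
  comb-zero (e ∷ es)   (zero ∷ x)  t = comb-zero es x t
  comb-zero (e ∷ es)   (suc i ∷ x) t =
    ≈-trans (⊕-cong (≈-trans (⊗-congˡ (e t)) (zeroʳ _)) (comb-zero es x t)) (⊕-identityʳ 0#)

  cnt-zero : ∀ {n r} k {cols : Vec (V n) r} → All (_≋ 0ⱽ) cols → cnt k cols ≡ sphere Q r k
  cnt-zero {r = r} k {cols} es = trans (∑ⱽ-cong r λ x →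
    trans (cong (λ m → [ wt x + m ≡? k ]) (ω-zero (comb-zero es x))) (cong [_≡? k ] (+-identityʳ (wt x))))
    (∑ⱽ-sphere Q r k)

  el-cancel : ∀ {n i} {a : V n} → ¬ a ≋ 0ⱽ → ¬ el (suc i) · a ≋ 0ⱽ
  el-cancel {i = i} {a} a≋̸0 h with c , elc≈1 ← inverse (el (suc i)) (el-suc i) = a≋̸0 λ t → begin
    a t                          ≈⟨ ≈-sym (⊗-identityˡ (a t)) ⟩
    1# ⊗ a t                     ≈⟨ ⊗-congʳ (≈-sym elc≈1) ⟩
    (el (suc i) ⊗ c) ⊗ a t       ≈⟨ ⊗-congʳ (⊗-comm _ c) ⟩
    (c ⊗ el (suc i)) ⊗ a t       ≈⟨ ⊗-assoc c _ (a t) ⟩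
    c ⊗ (el (suc i) ⊗ a t)       ≈⟨ ⊗-congˡ (h t) ⟩
    c ⊗ 0#                       ≈⟨ zeroʳ c ⟩
    0#                           ∎
    where open ≈-Reasoning

  el-cancelˡ : ∀ {n i} {a b : V n} → ¬ a ≋ b → ¬ el (suc i) · a ≋ el (suc i) · b
  el-cancelˡ {i = i} {a} {b} a≋̸b h with c , elc≈1 ← inverse (el (suc i)) (el-suc i) = a≋̸b λ t → begin
    a t                          ≈⟨ unscale (a t) ⟩
    c ⊗ (el (suc i) ⊗ a t)       ≈⟨ ⊗-congˡ (h t) ⟩
    c ⊗ (el (suc i) ⊗ b t)       ≈⟨ ≈-sym (unscale (b t)) ⟩
    b t                          ∎
    where
    open ≈-Reasoning
    unscale : ∀ z → z ≈ c ⊗ (el (suc i) ⊗ z)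
    unscale z = ≈-trans (≈-sym (⊗-identityˡ z)) (≈-trans (⊗-congʳ (≈-trans (≈-sym elc≈1) (⊗-comm _ c))) (⊗-assoc c _ z))

  el-cancelʳ : ∀ {n y z} {a : V n} → y ≢ z → ¬ a ≋ 0ⱽ → ¬ el y · a ≋ el z · a
  el-cancelʳ {y = y} {z} {a} y≢z a≋̸0 h with p , ap≉0 ← Fin.¬∀⟶∃¬ _ _ (λ t → a t ≈? 0#) a≋̸0
                                   with c , apc≈1 ← inverse _ ap≉0 = y≢z (el-injective (begin
    el y                  ≈⟨ unscale (el y) ⟩
    (el y ⊗ a p) ⊗ c      ≈⟨ ⊗-congʳ (h p) ⟩
    (el z ⊗ a p) ⊗ c      ≈⟨ ≈-sym (unscale (el z)) ⟩
    el z                  ∎))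
    where
    open ≈-Reasoning
    unscale : ∀ e → e ≈ (e ⊗ a p) ⊗ c
    unscale e = ≈-trans (≈-sym (⊗-identityʳ e)) (≈-trans (⊗-congˡ (≈-sym apc≈1)) (≈-sym (⊗-assoc e _ c)))

  sgn-ω : ∀ {n} {v : V n} → ¬ v ≋ 0ⱽ → sgn (ω v) ≡ 1
  sgn-ω {v = v} v≋̸0 with ω v in eq
  ... | zero  = contradiction (ω≡0⇒≋0 eq) v≋̸0
  ... | suc _ = refl

  sgn-ω-+ : ∀ {n} {u u′ : V n} v → ¬ u ≋ u′ → 1 ≤ sgn (ω (u ⊞ v)) + sgn (ω (u′ ⊞ v))
  sgn-ω-+ {u = u} {u′} v u≋̸u′ with (u ⊞ v) ≋? 0ⱽ
  ... | no  ≋̸0 = ≤-trans (≤-reflexive (sym (sgn-ω ≋̸0))) (m≤m+n _ _)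
  ... | yes ≋0 = ≤-trans (≤-reflexive (sym (sgn-ω λ ≋0′ → u≋̸u′ λ t →
          ⊕-cancelʳ (v t) (u t) (u′ t) (≈-trans (≋0 t) (≈-sym (≋0′ t)))))) (m≤n+m _ _)

  -- Misses that remain once a nonzero coefficient of an earlier column has contributed `u`; `e` is
  -- the weight still to be placed.
  mis-shifted : ∀ {n r} → ℕ → V n → Vec (V n) r → ℕ
  mis-shifted {r = r} e u cols = ∑ⱽ r (λ x → [ wt x ≡? e ] * sgn (ω (u ⊞ comb x cols)))

  -- By cancellation `u ⊞ v` and `u′ ⊞ v` cannot both vanish, so each x of weight e is counted in at
  -- least one of the two sums.
  mis-shifted-+ : ∀ {n r} e {u u′} (cols : Vec (V n) r) → ¬ u ≋ u′ →
    sphere Q r e ≤ mis-shifted e u cols + mis-shifted e u′ cols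
  mis-shifted-+ {r = r} e {u} {u′} cols u≋̸u′ = begin
    sphere Q r e                          ≡⟨ sym (∑ⱽ-sphere Q r e) ⟩
    ∑ⱽ r (λ x → [ wt x ≡? e ])            ≤⟨ ∑ⱽ-mono r (λ x → pointwise [ wt x ≡? e ] (sgn-ω-+ (comb x cols) u≋̸u′)) ⟩
    ∑ⱽ r (λ x → [ wt x ≡? e ] * sgn (ω (u ⊞ comb x cols)) + [ wt x ≡? e ] * sgn (ω (u′ ⊞ comb x cols)))
                                          ≡⟨ ∑ⱽ-+ r _ _ ⟩
    mis-shifted e u cols + mis-shifted e u′ cols ∎
    where
    open ≤-Reasoning
    pointwise : ∀ a {b c} → 1 ≤ b + c → a ≤ a * b + a * c
    pointwise a {b} {c} h = ≤-trans (≤-reflexive (sym (*-identityʳ a))) (≤-trans (*-monoʳ-≤ a h) (≤-reflexive (*-distribˡ-+ a b c)))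

  -- Distinct nonzero scalars y and z exist only for q at least 3. Then y·a and z·a are distinct
  -- offsets, which yields one batch of misses; coefficient zero on `a` supplies the misses of
  -- `cols`.
  mis-nonzero : ∀ {n r} e {i j : Fin Q} → i ≢ j → {a : V n} → ¬ a ≋ 0ⱽ → (cols : Vec (V n) r) →
    sphere Q r e + mis (suc e) cols ≤ mis (suc e) (a ∷ cols)
  mis-nonzero {r = r} e {i} {j} i≢j {a} a≋̸0 cols = begin
    sphere Q r e + mis (suc e) cols
      ≡⟨ +-comm (sphere Q r e) _ ⟩
    mis (suc e) cols + sphere Q r e
      ≤⟨ +-monoʳ-≤ (mis (suc e) cols) (≤-trans (mis-shifted-+ e cols (el-cancelʳ (i≢j ∘ Fin.suc-injective) a≋̸0)) (f+f≤∑ _ i≢j)) ⟩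
    mis (suc e) cols + ∑ {Q} (λ i → mis-shifted e (el (suc i) · a) cols) ∎
    where open ≤-Reasoning

  -- If a ≠ b, then not both y·a + v and y·b + v vanish, for a nonzero scalar y.
  mis-distinct : ∀ {n r} e (i : Fin Q) {a b : V n} → ¬ a ≋ b → (cols : Vec (V n) r) →
    sphere Q r e + mis (suc e) cols ≤ mis (suc e) (a ∷ b ∷ cols)
  mis-distinct {r = r} e i {a} {b} a≋̸b cols = begin
    sphere Q r e + mis (suc e) cols
      ≤⟨ +-monoˡ-≤ (mis (suc e) cols) (mis-shifted-+ e cols (el-cancelˡ a≋̸b)) ⟩
    shifted a i + shifted b i + mis (suc e) cols
      ≤⟨ +-monoˡ-≤ (mis (suc e) cols) (+-mono-≤ (≤-trans (m≤m+n (shifted a i) _) (f≤∑ _ i)) (f≤∑ (shifted b) i)) ⟩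
    ∑ {Q} (λ i → mis-shifted e (el (suc i) · a) (b ∷ cols)) + ∑ {Q} (shifted b) + mis (suc e) cols
      ≡⟨ regroup (∑ {Q} (λ i → mis-shifted e (el (suc i) · a) (b ∷ cols))) (∑ {Q} (shifted b)) _ ⟩
    mis (suc e) cols + ∑ {Q} (shifted b) + ∑ {Q} (λ i → mis-shifted e (el (suc i) · a) (b ∷ cols)) ∎
    where
    open ≤-Reasoning
    shifted : V _ → Fin Q → ℕ
    shifted c i = mis-shifted e (el (suc i) · c) cols
    regroup : ∀ a b c → a + b + c ≡ c + b + a
    regroup = solve-∀

  -- Here coordinate 0 is repeated in Ax, so that it contributes at least 2 to the weight.
  cnt-one-nonzero : ∀ {n r} e {a : V n} → ¬ a ≋ 0ⱽ → {cols : Vec (V n) r} → All (_≋ 0ⱽ) cols →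
    ball Q r e ≤ sphere Q r e → cnt (suc e) (a ∷ cols) ≤ sphere Q (suc r) (suc e)
  cnt-one-nonzero {r = r} e {a} a≋̸0 {cols} es ball≤ = +-mono-≤ (≤-reflexive (cnt-zero (suc e) es)) (begin
    ∑ {Q} (λ i → ∑ⱽ r (λ x → [ wt x + ω (el (suc i) · a ⊞ comb x cols) ≡? e ]))
      ≤⟨ ∑-mono {Q} (λ i → ∑ⱽ-mono r (λ x → pointwise i x)) ⟩
    ∑ {Q} (λ i → ∑ⱽ r (λ x → [ wt {Q} x <? e ]))
      ≡⟨ trans (sum-cong-≗ {n = Q} (λ _ → ∑ⱽ-ball Q r e)) (∑-const Q _) ⟩
    Q * ball Q r e
      ≤⟨ *-monoʳ-≤ Q ball≤ ⟩
    Q * sphere Q r e ∎)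
    where
    open ≤-Reasoning
    pointwise : ∀ i x → [ wt x + ω (el (suc i) · a ⊞ comb x cols) ≡? e ] ≤ [ wt x <? e ]
    pointwise i x with ω (el (suc i) · a ⊞ comb x cols) in eq
    ... | zero  = contradiction (λ t → ≈-trans (≈-sym (≈-trans (⊕-congˡ (comb-zero es x t)) (⊕-identityʳ _))) (ω≡0⇒≋0 eq t))
                    (el-cancel {i = i} a≋̸0)
    ... | suc m = [j+1+m≡?]≤[j<?] (wt x) m e

  -- Equal columns over the field with two elements

  alternate : ∀ {n} → V n → ℕ → V n
  alternate v zero          = 0ⱽ
  alternate v (suc zero)    = v
  alternate v (suc (suc j)) = alternate v j

  alternate-odd : ∀ {n} (v : V n) {k} → ¬ 2 ∣ k → alternate v k ≡ v
  alternate-odd v {zero}        odd = contradiction (2 ∣0) odd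
  alternate-odd v {suc zero}    odd = refl
  alternate-odd v {suc (suc k)} odd = alternate-odd v (λ 2∣k → odd (∣m∣n⇒∣m+n ∣-refl 2∣k))

  alternate-cases : ∀ {n} (v : V n) j → alternate v j ≡ 0ⱽ ⊎ alternate v j ≡ v
  alternate-cases v zero          = inj₁ refl
  alternate-cases v (suc zero)    = inj₂ refl
  alternate-cases v (suc (suc j)) = alternate-cases v j

  module Binary (Q≡1 : Q ≡ 1) where
    i₁ : Fin Q
    i₁ = subst Fin (sym Q≡1) zero

    el-suc≈1 : ∀ i → el (suc i) ≈ 1#
    el-suc≈1 i with code 1# in eq
    ... | zero  = contradiction (el-code-≈0 eq) 1≉0
    ... | suc j = ≈-trans (≈-reflexive (cong (el ∘ suc) (Fin1-prop Q≡1 i j))) (≈-trans (≈-reflexive (cong el (sym eq))) (el-code 1#))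
      where
      Fin1-prop : ∀ {n} → n ≡ 1 → (i j : Fin n) → i ≡ j
      Fin1-prop refl zero zero = refl

    nonzero⇒≈1 : ∀ {x} → ¬ x ≈ 0# → x ≈ 1#
    nonzero⇒≈1 {x} x≉0 with code x in eq
    ... | zero  = contradiction (el-code-≈0 eq) x≉0
    ... | suc i = ≈-trans (≈-sym (el-code x)) (≈-trans (≈-reflexive (cong el eq)) (el-suc≈1 i))

    -- Otherwise 1 + 1 would be the only nonzero element 1, and cancellation would give 1 = 0.
    1+1≈0 : 1# ⊕ 1# ≈ 0#
    1+1≈0 with (1# ⊕ 1#) ≈? 0#
    ... | yes h = h
    ... | no  h = contradiction (⊕-cancelʳ 1# 1# 0# (≈-trans (nonzero⇒≈1 h) (≈-sym (⊕-identityˡ 1#)))) 1≉0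

    x+x≈0 : ∀ x → x ⊕ x ≈ 0#
    x+x≈0 x = ≈-trans (≈-sym (⊕-cong (⊗-identityˡ x) (⊗-identityˡ x)))
      (≈-trans (≈-sym (distribʳ x 1# 1#)) (≈-trans (⊗-congʳ 1+1≈0) (zeroˡ x)))

    alternate-suc : ∀ {n} (v : V n) j → v ⊞ alternate v j ≋ alternate v (suc j)
    alternate-suc v zero          t = ⊕-identityʳ (v t)
    alternate-suc v (suc zero)    t = x+x≈0 (v t)
    alternate-suc v (suc (suc j)) t = alternate-suc v j t

    -- In characteristic two a sum of j copies of v depends only on the parity of j, which
    -- `alternate` records.
    comb-constant : ∀ {n r} {v : V n} {cols : Vec (V n) r} → All (_≋ v) cols →
      ∀ x → comb x cols ≋ alternate v (wt x)
    comb-constant []       []          t = ≈-refl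
    comb-constant (e ∷ es) (zero ∷ x)  t = comb-constant es x t
    comb-constant {v = v} (e ∷ es) (suc i ∷ x) t = ≈-trans
      (⊕-cong (≈-trans (⊗-cong (el-suc≈1 i) (e t)) (⊗-identityˡ _)) (comb-constant es x t))
      (alternate-suc v (wt x) t)

    -- For odd k every x of weight k gives Ax = v, so all of them are misses.
    mis-constant : ∀ {n r k} {v : V n} {cols : Vec (V n) r} → ¬ 2 ∣ k → ¬ v ≋ 0ⱽ → All (_≋ v) cols →
      mis k cols ≡ sphere Q r k
    mis-constant {r = r} {k} {v} {cols} odd v≋̸0 es = trans (∑ⱽ-cong r pointwise) (∑ⱽ-sphere Q r k)
      where
      pointwise : ∀ x → [ wt x ≡? k ] * sgn (ω (comb x cols)) ≡ [ wt x ≡? k ]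
      pointwise x with wt x ≟ k
      ... | yes wt≡k = trans (cong ([ wt x ≡? k ] *_) (trans (cong sgn (trans (ω-cong (comb-constant es x))
                         (cong ω (trans (cong (alternate v) wt≡k) (alternate-odd v odd))))) (sgn-ω v≋̸0)))
                         (*-identityʳ _)
      ... | no wt≢k = trans (cong (_* sgn (ω (comb x cols))) ([≢?] wt≢k)) (sym ([≢?] wt≢k))
        where
        [≢?] : ∀ {j k} → j ≢ k → [ j ≡? k ] ≡ 0
        [≢?] {zero}  {zero}  j≢k = contradiction refl j≢k
        [≢?] {zero}  {suc k} j≢k = refl
        [≢?] {suc j} {zero}  j≢k = refl
        [≢?] {suc j} {suc k} j≢k = [≢?] (j≢k ∘ cong suc)

    -- If v has weight w + 1, then x hits only with Ax = 0 and weight e + 1, or with Ax = v and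
    -- weight e - w. The second kind numbers at most N_e: equality for w = 0, and `ball≤` for larger
    -- w. For Q = 1, N_{e+1} + N_e is the sphere in one more dimension.
    cnt-constant : ∀ {n r} e {v : V n} {cols : Vec (V n) r} → All (_≋ v) cols → ball Q r e ≤ sphere Q r e →
      cnt (suc e) cols ≤ sphere Q (suc r) (suc e)
    cnt-constant {n} {r} e {v} {cols} es ball≤ with ω v in eq
    ... | zero = ≤-trans (≤-reflexive (cnt-zero (suc e) zeros)) (m≤m+n _ _)
      where
      zeros : All (_≋ 0ⱽ) cols
      zeros = All.map (λ a≋v t → ≈-trans (a≋v t) (ω≡0⇒≋0 eq t)) es
    ... | suc w = begin
      cnt (suc e) cols
        ≤⟨ ∑ⱽ-mono r pointwise ⟩
      ∑ⱽ r (λ x → [ wt x ≡? suc e ] + [ wt x + w ≡? e ])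
        ≡⟨ ∑ⱽ-+ r _ _ ⟩
      ∑ⱽ r (λ x → [ wt x ≡? suc e ]) + ∑ⱽ r (λ x → [ wt x + w ≡? e ])
        ≤⟨ +-mono-≤ (≤-reflexive (∑ⱽ-sphere Q r (suc e))) (below w) ⟩
      sphere Q r (suc e) + sphere Q r e
        ≡⟨ cong (sphere Q r (suc e) +_) (sym (trans (cong (_* sphere Q r e) Q≡1) (*-identityˡ _))) ⟩
      sphere Q r (suc e) + Q * sphere Q r e ∎
      where
      open ≤-Reasoning
      pointwise : ∀ x → [ wt x + ω (comb x cols) ≡? suc e ] ≤ [ wt x ≡? suc e ] + [ wt x + w ≡? e ]
      pointwise x with alternate-cases v (wt x)
      ... | inj₁ ≡0 = ≤-trans (≤-reflexive (cong [_≡? suc e ] (trans (cong (wt x +_) (trans (ω-cong (comb-constant es x)) (trans (cong ω ≡0) (ω-zero {n} (λ _ → ≈-refl))))) (+-identityʳ (wt x))))) (m≤m+n _ _)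
      ... | inj₂ ≡v = ≤-trans (≤-reflexive (cong [_≡? suc e ] (trans (cong (wt x +_) (trans (ω-cong (comb-constant es x)) (trans (cong ω ≡v) eq))) (+-suc (wt x) w)))) (m≤n+m _ _)
      below : ∀ w → ∑ⱽ r (λ x → [ wt x + w ≡? e ]) ≤ sphere Q r e
      below zero    = ≤-reflexive (trans (∑ⱽ-cong r (λ x → cong [_≡? e ] (+-identityʳ (wt x)))) (∑ⱽ-sphere Q r e))
      below (suc w) = ≤-trans (∑ⱽ-mono r (λ x → [j+1+m≡?]≤[j<?] (wt x) w e)) (≤-trans (≤-reflexive (∑ⱽ-ball Q r e)) ball≤)

  -- From matrices to counts of hits

  comb-tabulate : ∀ {n r} (a : Fin r → Carrier) (b : Fin r → V n) →
    comb (tabulate (code ∘ a)) (tabulate b) ≋ λ t → sum (λ s → a s ⊗ b s t)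
  comb-tabulate {r = zero}  a b t = ≈-refl
  comb-tabulate {r = suc r} a b t = ≈-trans (comb-∷ _ _ (b zero) _ t)
    (⊕-cong (⊗-congʳ (el-code (a zero))) (comb-tabulate (a ∘ suc) (b ∘ suc) t))

  -- With offset zero the remaining entries are a function of `y i` alone. So `recover` makes `y`
  -- injective on the distinct columns, and `weight` makes every `y i` a hit.
  achievable-≤ : ∀ {r k m N} → (∀ {n} (cols : Vec (V n) r) → cnt k cols ≤ N) → Achievable F r k m → m ≤ N
  achievable-≤ {r} {k} {m} cnt≤N (n , c , distinct , weights , b , a , c≈) =
    ≤-trans (injection-≤-∑ⱽ r _ y y-injective hit) (cnt≤N cols′)
    where
    open Systematic (systematic (tabulate b))
    open IsLinear M-linear
    x y : Fin m → Vec (Fin (suc Q)) r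
    x i = tabulate (code ∘ a i)
    y i = φ 0ⱽ (x i)
    c≋ : ∀ i → c i ≋ 0ⱽ ⊞ comb (x i) (tabulate b)
    c≋ i t = ≈-trans (c≈ i t) (≈-trans (≈-sym (comb-tabulate (a i) b t)) (≈-sym (⊕-identityˡ _)))
    rest≋ : ∀ i → rest 0ⱽ (x i) ≋ comb (y i) cols′
    rest≋ i t = ≈-trans (⊕-congʳ (M-zero t)) (⊕-identityˡ _)
    y-injective : ∀ i j → y i ≡ y j → i ≡ j
    -- `DistinctCols` only refutes equal columns at different indices, so `i ≡ j` comes through
    -- double negation.
    y-injective i j eq = decidable-stable (i Fin.≟ j) λ i≢j → distinct i j i≢j λ t →
      ≈-trans (c≋ i t) (≈-trans (recover 0ⱽ 0ⱽ (x i) (x j) eq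
        (λ s → ≈-trans (rest≋ i s) (≈-trans (≈-reflexive (cong (λ z → comb z cols′ s) eq)) (≈-sym (rest≋ j s)))) t)
        (≈-sym (c≋ j t)))
    hit : ∀ i → hits k (wt (y i)) (comb (y i) cols′) ≡ 1
    hit i = trans (cong [_≡? k ] (begin
      wt (y i) + ω (comb (y i) cols′)       ≡⟨ cong (wt (y i) +_) (sym (ω-cong (rest≋ i))) ⟩
      wt (y i) + ω (rest 0ⱽ (x i))          ≡⟨ sym (weight 0ⱽ (x i)) ⟩
      ω (0ⱽ ⊞ comb (x i) (tabulate b))      ≡⟨ sym (ω-cong (c≋ i)) ⟩
      ω (c i)                               ≡⟨ HasWeight⇒ω (weights i) ⟩
      k                                     ∎)) ([≡?]-refl k)
      where open ≡-Reasoning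

  one-code : ∃ λ i → code 1# ≡ suc i
  one-code with code 1# in eq
  ... | zero  = contradiction (el-code-≈0 eq) 1≉0
  ... | suc i = i , refl

  1≤Q : 1 ≤ Q
  1≤Q = Fin⇒1≤ (proj₁ one-code)
    where
    Fin⇒1≤ : ∀ {n} → Fin n → 1 ≤ n
    Fin⇒1≤ {suc n} _ = s≤s z≤n

  q≡2⇒Q≡1 : q ≡ 2 → Q ≡ 1
  q≡2⇒Q≡1 q≡2 = suc-injective (trans (sym q≡1+Q) q≡2)

  binary-or-larger : Q ≡ 1 ⊎ Σ (Fin Q) λ i → Σ (Fin Q) λ j → i ≢ j
  binary-or-larger = split 1≤Q
    where
    split : ∀ {n} → 1 ≤ n → n ≡ 1 ⊎ Σ (Fin n) λ i → Σ (Fin n) λ j → i ≢ j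
    split {suc zero}    _ = inj₁ refl
    split {suc (suc n)} _ = inj₂ (zero , suc zero , λ ())

  -- Upper bounds on hits by the shape of the columns

  constant-or-distinct : ∀ {n r} (cols : Vec (V n) (2 + r)) →
    (Σ (V n) λ v → All (_≋ v) cols) ⊎
    (Σ (V n) λ a → Σ (V n) λ b → Σ (Vec (V n) r) λ cols′ →
      ¬ a ≋ b × cols ≃ a ∷ b ∷ cols′)
  constant-or-distinct (v ∷ cols) with find≋̸ v cols
  ... | inj₁ cols≋v = inj₁ (v , (λ _ → ≈-refl) ∷ cols≋v)
  ... | inj₂ (a , cols′ , a≋̸v , p) = inj₂ (a , v , cols′ , a≋̸v , ≃-pick (there p))

  -- `r` counts the columns left when two disjoint pairs are set aside. `b≤s` absorbs lower-order
  -- terms, `b≤s⁺` handles constant nonzero columns at odd weight, and `b≤2s` is the comparison with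
  -- two batches of misses.
  module _ {r e : ℕ}
    (b≤s  : ball Q (4 + r) e ≤ sphere Q r e)
    (b≤s⁺ : ball Q (4 + r) (suc e) ≤ sphere Q r (suc e))
    (b≤2s : ball Q (4 + r) (suc e) ≤ sphere Q r e + sphere Q r e) where

    private
      s₁ : sphere Q r e ≤ sphere Q (1 + r) e
      s₁ = sphere-mono Q r e
      s₂ : sphere Q r e ≤ sphere Q (2 + r) e
      s₂ = ≤-trans s₁ (sphere-mono Q (1 + r) e)
      s₃ : sphere Q r e ≤ sphere Q (3 + r) e
      s₃ = ≤-trans s₂ (sphere-mono Q (2 + r) e)
      b₃ : ball Q (3 + r) e ≤ sphere Q (3 + r) e
      b₃ = ≤-trans (ball-mono Q (3 + r) e) (≤-trans b≤s s₃)

      one-nonzero : ∀ {n a} {as : Vec (V n) (4 + r)} {bs} → ¬ a ≋ 0ⱽ → All (_≋ 0ⱽ) bs → Pick a as bs →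
        cnt (suc e) as ≤ sphere Q (4 + r) (suc e)
      one-nonzero a≋̸0 es p = ≤-trans (≤-reflexive (cnt-≃ (suc e) (≃-pick p))) (cnt-one-nonzero e a≋̸0 es b₃)

    -- One nonzero column guarantees a single batch of misses, which need not cover the lower terms
    -- of the excess. That case is therefore counted directly, and misses are used from two nonzero
    -- columns on.
    cnt-larger : ∀ {i j : Fin Q} → i ≢ j → ∀ {n} (cols : Vec (V n) (4 + r)) → cnt (suc e) cols ≤ sphere Q (4 + r) (suc e)
    cnt-larger i≢j cols with find≋̸ 0ⱽ cols
    ... | inj₁ es = ≤-reflexive (cnt-zero (suc e) es)
    ... | inj₂ (a , cols₁ , a≋̸0 , p) with find≋̸ 0ⱽ cols₁
    ...   | inj₁ es = one-nonzero a≋̸0 es p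
    ...   | inj₂ (b , cols₂ , b≋̸0 , p′) = cnt≤sphere (suc e) cols (begin
      ball Q (4 + r) (suc e)                                  ≤⟨ b≤2s ⟩
      sphere Q r e + sphere Q r e                             ≤⟨ +-mono-≤ s₃ s₂ ⟩
      sphere Q (3 + r) e + sphere Q (2 + r) e                 ≤⟨ +-monoʳ-≤ (sphere Q (3 + r) e) (m≤m+n _ (mis (suc e) cols₂)) ⟩
      sphere Q (3 + r) e + (sphere Q (2 + r) e + mis (suc e) cols₂)
        ≤⟨ +-monoʳ-≤ (sphere Q (3 + r) e) (mis-nonzero e i≢j b≋̸0 cols₂) ⟩
      sphere Q (3 + r) e + mis (suc e) (b ∷ cols₂)            ≡⟨ cong (sphere Q (3 + r) e +_) (sym (mis-≃ (suc e) (≃-pick p′))) ⟩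
      sphere Q (3 + r) e + mis (suc e) cols₁                  ≤⟨ mis-nonzero e i≢j a≋̸0 cols₁ ⟩
      mis (suc e) (a ∷ cols₁)                                 ≡⟨ sym (mis-≃ (suc e) (≃-pick p)) ⟩
      mis (suc e) cols                                        ∎)
      where open ≤-Reasoning

    module _ (Q≡1 : Q ≡ 1) where
      open Binary Q≡1

      private
        two-pairs : ∀ {n} {a b c d : V n} {cols} (cols′ : Vec (V n) r) → ¬ a ≋ b → ¬ c ≋ d →
          cols ≃ a ∷ b ∷ c ∷ d ∷ cols′ →
          cnt (suc e) cols ≤ sphere Q (4 + r) (suc e)
        two-pairs {a = a} {b} {c} {d} {cols} cols′ a≋̸b c≋̸d p = cnt≤sphere (suc e) cols (begin
          ball Q (4 + r) (suc e)                                  ≤⟨ b≤2s ⟩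
          sphere Q r e + sphere Q r e                             ≤⟨ +-mono-≤ s₂ (m≤m+n _ (mis (suc e) cols′)) ⟩
          sphere Q (2 + r) e + (sphere Q r e + mis (suc e) cols′) ≤⟨ +-monoʳ-≤ (sphere Q (2 + r) e) (mis-distinct e i₁ c≋̸d cols′) ⟩
          sphere Q (2 + r) e + mis (suc e) (c ∷ d ∷ cols′)        ≤⟨ mis-distinct e i₁ a≋̸b (c ∷ d ∷ cols′) ⟩
          mis (suc e) (a ∷ b ∷ c ∷ d ∷ cols′)                     ≡⟨ sym (mis-≃ (suc e) p) ⟩
          mis (suc e) cols                                        ∎)
          where open ≤-Reasoning

        all-≋0 : ∀ {n m} {v : V n} {as : Vec (V n) m} → v ≋ 0ⱽ → All (_≋ v) as → All (_≋ 0ⱽ) as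
        all-≋0 v≋0 = All.map (λ a≋v t → ≈-trans (a≋v t) (v≋0 t))

        b≤s⁺₂ : ball Q (4 + r) (suc e) ≤ sphere Q (2 + r) (suc e)
        b≤s⁺₂ = ≤-trans b≤s⁺ (≤-trans (sphere-mono Q r (suc e)) (sphere-mono Q (1 + r) (suc e)))

      -- If the columns are a constant v ≠ 0, at least beyond a first unequal pair, oddness turns
      -- enough x of full weight into misses. Otherwise there are two disjoint unequal pairs or at
      -- most one nonzero column.
      cnt-binary-odd : ¬ 2 ∣ suc e → ∀ {n} (cols : Vec (V n) (4 + r)) → cnt (suc e) cols ≤ sphere Q (4 + r) (suc e)
      cnt-binary-odd odd cols with constant-or-distinct cols
      ... | inj₁ (v , es) with v ≋? 0ⱽ
      ...   | yes v≋0 = ≤-reflexive (cnt-zero (suc e) (all-≋0 v≋0 es))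
      ...   | no  v≋̸0 = cnt≤sphere (suc e) cols (≤-trans b≤s⁺₂
              (≤-trans (sphere-mono Q (2 + r) (suc e)) (≤-trans (sphere-mono Q (3 + r) (suc e)) (≤-reflexive (sym (mis-constant odd v≋̸0 es))))))
      cnt-binary-odd odd cols | inj₂ (a , b , cols₁ , a≋̸b , p) with constant-or-distinct cols₁
      ... | inj₂ (c , d , cols₂ , c≋̸d , p′) = two-pairs {cols = cols} cols₂ a≋̸b c≋̸d
              (≃-trans p (≃-prep a (≃-prep b p′)))
      ... | inj₁ (v , es) with v ≋? 0ⱽ
      ...   | no  v≋̸0 = cnt≤sphere (suc e) cols (begin
        ball Q (4 + r) (suc e)                       ≤⟨ b≤s⁺₂ ⟩
        sphere Q (2 + r) (suc e)                     ≡⟨ sym (mis-constant odd v≋̸0 es) ⟩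
        mis (suc e) cols₁                            ≤⟨ m≤n+m _ (sphere Q (2 + r) e) ⟩
        sphere Q (2 + r) e + mis (suc e) cols₁       ≤⟨ mis-distinct e i₁ a≋̸b cols₁ ⟩
        mis (suc e) (a ∷ b ∷ cols₁)                  ≡⟨ sym (mis-≃ (suc e) p) ⟩
        mis (suc e) cols                             ∎)
        where open ≤-Reasoning
      ...   | yes v≋0 with a ≋? 0ⱽ | b ≋? 0ⱽ
      ...     | yes a≋0 | _ = ≤-trans (≤-reflexive (cnt-≃ (suc e) p))
                  (one-nonzero (λ b≋0 → a≋̸b (λ t → ≈-trans (a≋0 t) (≈-sym (b≋0 t)))) (a≋0 ∷ all-≋0 v≋0 es) (there here))
      ...     | no a≋̸0 | yes b≋0 = ≤-trans (≤-reflexive (cnt-≃ (suc e) p))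
                  (one-nonzero a≋̸0 (b≋0 ∷ all-≋0 v≋0 es) here)
      -- Here `a` and `b` are nonzero and all other columns vanish. Moving the zero column `z` to
      -- the front yields the unequal pairs (z, a) and (b, z′).
      cnt-binary-odd odd cols | inj₂ (a , b , z ∷ z′ ∷ cols₂ , a≋̸b , p) | inj₁ (v , z≋v ∷ z′≋v ∷ es) | yes v≋0 | no a≋̸0 | no b≋̸0 =
        two-pairs {cols = cols} cols₂
          (λ z≋a → a≋̸0 (λ t → ≈-trans (≈-sym (z≋a t)) (≈-trans (z≋v t) (v≋0 t))))
          (λ b≋z′ → b≋̸0 (λ t → ≈-trans (b≋z′ t) (≈-trans (z′≋v t) (v≋0 t))))
          (≃-trans p (≃-pick (there (there here))))

      -- The target already contains N_e, the top term of the excess. Only the weights below e must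
      -- be offset, and one unequal pair does that; constant columns are counted directly.
      cnt-binary : ∀ {n} (cols : Vec (V n) (4 + r)) → cnt (suc e) cols ≤ sphere Q (5 + r) (suc e)
      cnt-binary cols with constant-or-distinct cols
      ... | inj₁ (v , es) = cnt-constant e es (≤-trans b≤s (≤-trans s₃ (sphere-mono Q (3 + r) e)))
      ... | inj₂ (a , b , cols₁ , a≋̸b , p) = +-cancelʳ-≤ (mis (suc e) cols) _ _ (begin
        cnt (suc e) cols + mis (suc e) cols                  ≤⟨ cnt+mis≤ (suc e) cols ⟩
        S⁺ + ball Q (4 + r) (suc e)                          ≡⟨ cong (S⁺ +_) (trans (ball-suc Q (4 + r) e) (+-comm (ball Q (4 + r) e) S)) ⟩
        S⁺ + (S + ball Q (4 + r) e)                          ≡⟨ sym (+-assoc S⁺ S _) ⟩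
        S⁺ + S + ball Q (4 + r) e                            ≤⟨ +-mono-≤ (≤-reflexive (cong (S⁺ +_) S≡QS)) missed ⟩
        sphere Q (5 + r) (suc e) + mis (suc e) cols          ∎)
        where
        open ≤-Reasoning
        S⁺ = sphere Q (4 + r) (suc e)
        S  = sphere Q (4 + r) e
        S≡QS : S ≡ Q * S
        S≡QS = sym (trans (cong (_* S) Q≡1) (*-identityˡ S))
        missed : ball Q (4 + r) e ≤ mis (suc e) cols
        missed = ≤-trans (≤-trans b≤s (≤-trans s₂ (m≤m+n _ (mis (suc e) cols₁))))
          (≤-trans (mis-distinct e i₁ a≋̸b cols₁) (≤-reflexive (sym (mis-≃ (suc e) p))))

  -- Constructions attaining the bounds

  vector : ∀ {r} → Vec (Fin (suc Q)) r → V r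
  vector x t = el (lookup x t)

  vector-injective : ∀ {r} (x y : Vec (Fin (suc Q)) r) → vector x ≋ vector y → x ≡ y
  vector-injective x y h = trans (sym (tabulate∘lookup x)) (trans (tabulate-cong (λ t → el-injective (h t))) (tabulate∘lookup y))

  support : ∀ {r} → Vec (Fin (suc Q)) r → Subset r
  support []          = []
  support (zero ∷ x)  = outside ∷ support x
  support (suc _ ∷ x) = inside ∷ support x

  ∣support∣ : ∀ {r} (x : Vec (Fin (suc Q)) r) → ∣ support x ∣ ≡ wt x
  ∣support∣ []          = refl
  ∣support∣ (zero ∷ x)  = ∣support∣ x
  ∣support∣ (suc _ ∷ x) = cong suc (∣support∣ x)

  ∈support⇒ : ∀ {r} (x : Vec (Fin (suc Q)) r) i → i ∈ₛ support x → ¬ vector x i ≈ 0#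
  ∈support⇒ (suc j ∷ x) zero    here      = el-suc j
  ∈support⇒ (zero ∷ x)  (suc i) (there p) = ∈support⇒ x i p
  ∈support⇒ (suc j ∷ x) (suc i) (there p) = ∈support⇒ x i p

  ⇒∈support : ∀ {r} (x : Vec (Fin (suc Q)) r) i → ¬ vector x i ≈ 0# → i ∈ₛ support x
  ⇒∈support (zero ∷ x)  zero    h = contradiction el-zero h
  ⇒∈support (suc j ∷ x) zero    h = here
  ⇒∈support (zero ∷ x)  (suc i) h = there (⇒∈support x i h)
  ⇒∈support (suc j ∷ x) (suc i) h = there (⇒∈support x i h)

  vector-weight : ∀ {r k} (x : Vec (Fin (suc Q)) r) → wt x ≡ k → HasWeight F (vector x) k
  vector-weight x wt≡k = support x , trans (∣support∣ x) wt≡k , λ i → mk⇔ (∈support⇒ x i) (⇒∈support x i)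

  δ : ∀ {r} → Fin r → V r
  δ zero    zero    = 1#
  δ zero    (suc t) = 0#
  δ (suc s) zero    = 0#
  δ (suc s) (suc t) = δ s t

  sum-δ : ∀ {r} (v : V r) → v ≋ λ t → sum (λ s → v s ⊗ δ s t)
  sum-δ {suc r} v zero = ≈-sym (≈-trans (⊕-cong (⊗-identityʳ (v zero)) (sum-zero (v ∘ suc))) (⊕-identityʳ _))
    where
    sum-zero : ∀ {r} (v : V r) → sum (λ s → v s ⊗ 0#) ≈ 0#
    sum-zero {zero}  v = ≈-refl
    sum-zero {suc r} v = ≈-trans (⊕-cong (zeroʳ _) (sum-zero (v ∘ suc))) (⊕-identityʳ _)
  sum-δ {suc r} v (suc t) = ≈-sym (≈-trans (⊕-cong (zeroʳ (v zero)) (≈-sym (sum-δ (v ∘ suc) t))) (⊕-identityˡ _))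

  achievable-sphere : ∀ r k → Achievable F r k (sphere Q r k)
  achievable-sphere r k with x , wt≡k , x-inj ← enumerate-sphere Q r k =
    r , (λ i → vector (x i))
    , (λ i j i≢j h → i≢j (x-inj i j (vector-injective (x i) (x j) h)))
    , (λ i → vector-weight (x i) (wt≡k i))
    , δ , (λ i → vector (x i)) , (λ i → sum-δ (vector (x i)))

  module _ (Q≡1 : Q ≡ 1) where
    open Binary Q≡1

    alternate-even : ∀ {n} (v : V n) {k} → 2 ∣ k → alternate v k ≡ 0ⱽ
    alternate-even v {zero}        even = refl
    alternate-even v {suc zero}    even with () ← ∣1⇒≡1 even
    alternate-even v {suc (suc k)} even = alternate-even v (∣m+n∣m⇒∣n even ∣-refl)

    -- Writes the coordinate sum as a combination of copies of the length-one vector 1, so that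
    -- `comb-constant` evaluates it by parity.
    sum-vector : ∀ {r} (x : Vec (Fin (suc Q)) r) → sum (λ s → vector x s ⊗ 1#) ≈ comb x (replicate r (const {B = Fin 1} 1#)) zero
    sum-vector []      = ≈-refl
    sum-vector {suc r} (y ∷ x) = ≈-trans (⊕-congˡ (sum-vector x)) (≈-sym (comb-∷ y x (const 1#) (replicate r (const 1#)) zero))

    sum-even : ∀ {r k} (x : Vec (Fin (suc Q)) r) → 2 ∣ k → wt x ≡ k → sum (λ s → vector x s ⊗ 1#) ≈ 0#
    sum-even {r} x 2∣k wt≡k = ≈-trans (sum-vector x) (≈-trans (comb-constant (constant r) x zero)
      (≈-reflexive (cong (λ v → v zero) (alternate-even (const {B = Fin 1} 1#) (subst (2 ∣_) (sym wt≡k) 2∣k)))))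
      where
      constant : ∀ r → All (_≋ const 1#) (replicate r (const 1#))
      constant zero    = []
      constant (suc r) = (λ _ → ≈-refl) ∷ constant r

    -- The even-weight code, with basis e₀ + e_{s+1}.
    achievable-even : ∀ r k → 2 ∣ k → Achievable F r k (sphere Q (suc r) k)
    achievable-even r k 2∣k with x , wt≡k , x-inj ← enumerate-sphere Q (suc r) k =
      suc r , (λ i → vector (x i))
      , (λ i j i≢j h → i≢j (x-inj i j (vector-injective (x i) (x j) h)))
      , (λ i → vector-weight (x i) (wt≡k i))
      , b , (λ i s → vector (x i) (suc s)) , λ i → spanned (x i) (wt≡k i)
      where
      b : Fin r → V (suc r)
      b s zero    = 1#
      b s (suc t) = δ s t
      spanned : ∀ (x : Vec (Fin (suc Q)) (suc r)) → wt x ≡ k →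
        vector x ≋ λ t → sum (λ s → vector x (suc s) ⊗ b s t)
      spanned x@(_ ∷ _) wt≡k zero = ⊕-cancelʳ _ _ _ (≈-trans
        (≈-trans (⊕-congʳ (≈-sym (⊗-identityʳ _))) (sum-even x 2∣k wt≡k)) (≈-sym (x+x≈0 _)))
      spanned x wt≡k (suc t) = sum-δ (λ s → vector x (suc s)) t

  -- Exact values and the final choice of the threshold

  isEx-sphere : ∀ {r k} → (∀ {n} (cols : Vec (V n) r) → cnt k cols ≤ sphere Q r k) →
    IsEx F r k ((r C k) * ((q ∸ 1) ^ k))
  isEx-sphere {r} {k} bound = subst (IsEx F r k)
    (trans (sphere≡C*^ Q r k) (cong (λ m → (r C k) * (m ∸ 1) ^ k) (sym q≡1+Q)))
    (achievable-sphere r k , λ m′ → achievable-≤ bound)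

  isEx-even : ∀ {r k} → Q ≡ 1 → 2 ∣ k → (∀ {n} (cols : Vec (V n) r) → cnt k cols ≤ sphere Q (suc r) k) →
    IsEx F r k ((r + 1) C k)
  isEx-even {r} {k} Q≡1 2∣k bound = subst (IsEx F r k)
    (begin
      sphere Q (suc r) k     ≡⟨ cong (λ Q → sphere Q (suc r) k) Q≡1 ⟩
      sphere 1 (suc r) k     ≡⟨ sphere≡C*^ 1 (suc r) k ⟩
      (suc r C k) * 1 ^ k    ≡⟨ trans (cong ((suc r C k) *_) (^-zeroˡ k)) (*-identityʳ _) ⟩
      suc r C k              ≡⟨ cong (_C k) (+-comm 1 r) ⟩
      (r + 1) C k            ∎)
    (achievable-even Q≡1 r k 2∣k , λ m′ → achievable-≤ bound)
    where open ≡-Reasoning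

theorem1 : (k : ℕ) → Σ ℕ λ R → (F : FiniteField) → (r : ℕ) → R ≤ r →
    ((FiniteField.q F ≡ 2 × 2 ∣ k) → IsEx F r k ((r + 1) C k)) ×
    (¬ (FiniteField.q F ≡ 2 × 2 ∣ k) →
    IsEx F r k ((r C k) * ((FiniteField.q F ∸ 1) ^ k)))
-- `ball Q r 0` is 0, so no misses are required. The same bound serves the even case because
-- `sphere Q r 0` and `sphere Q (suc r) 0` both compute to 1.
theorem1 zero = 0 , λ F r _ → let open Extremal F in
    (λ (q≡2 , 2∣0) → isEx-even (q≡2⇒Q≡1 q≡2) 2∣0 (λ cols → cnt≤sphere 0 cols z≤n))
  , (λ _ → isEx-sphere (λ cols → cnt≤sphere 0 cols z≤n))
-- The comparisons are applied at `r ∸ 4`, which raises the threshold by 4.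
theorem1 (suc e) = proj₁ large + 4 , λ F r R≤r → subst (Claim F) (m+[n∸m]≡n (m+n≤o⇒n≤o (proj₁ large) R≤r))
    (claim F (r ∸ 4) (proj₂ large (r ∸ 4) (m+n≤o⇒m≤o∸n (proj₁ large) R≤r)))
  where
  -- Stated at Q = 1 with no field in scope, so that the threshold is fixed before F is chosen.
  Large : ℕ → Set
  Large r = ball 1 (4 + r) e < sphere 1 r e × ball 1 (4 + r) (suc e) < sphere 1 r (suc e)
          × ball 1 (4 + r) (suc e) < sphere 1 r e + sphere 1 r e

  large : Eventually Large
  large = eventually-∧ (ball<sphere e) (eventually-∧ (ball<sphere (suc e)) (ball<2*sphere e))

  Claim : FiniteField → ℕ → Set
  Claim F r =
    ((FiniteField.q F ≡ 2 × 2 ∣ suc e) → IsEx F r (suc e) ((r + 1) C suc e)) ×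
    (¬ (FiniteField.q F ≡ 2 × 2 ∣ suc e) → IsEx F r (suc e) ((r C suc e) * ((FiniteField.q F ∸ 1) ^ suc e)))

  claim : ∀ F r → Large r → Claim F (4 + r)
  claim F r (h , h⁺ , h₂) =
      (λ (q≡2 , 2∣k) → isEx-even (q≡2⇒Q≡1 q≡2) 2∣k (cnt-binary b≤s b≤s⁺ b≤2s (q≡2⇒Q≡1 q≡2)))
    , (λ not-even → isEx-sphere (bound not-even binary-or-larger))
    where
    open Extremal F
    b≤s  = ball≤sphere r e 1≤Q h
    b≤s⁺ = ball≤sphere r (suc e) 1≤Q h⁺
    b≤2s = ball≤2*sphere r e 1≤Q h₂
    bound : ¬ (FiniteField.q F ≡ 2 × 2 ∣ suc e) → (Q ≡ 1 ⊎ Σ (Fin Q) λ i → Σ (Fin Q) λ j → i ≢ j) →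
      ∀ {n} (cols : Vec (V n) (4 + r)) → cnt (suc e) cols ≤ sphere Q (4 + r) (suc e)
    bound not-even (inj₁ Q≡1) = cnt-binary-odd b≤s b≤s⁺ b≤2s Q≡1 (λ 2∣k → not-even (trans q≡1+Q (cong suc Q≡1) , 2∣k))
    bound not-even (inj₂ (_ , _ , i≢j)) = cnt-larger b≤s b≤s⁺ b≤2s i≢j
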